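{- Let $1\le k\le n$ and let $t$ be an integer with $0\le t\le\sigma_-(F_n^k)$. Then there exist an $n\times n$ alternating sign matrix $A_k$ with $\sigma_-(A_k)=t$ and $n\times n$ permutation matrices $P_1,\dots,P_{k-1},P_{k+1},\dots,P_n$ such that $[P_1,\dots,P_{k-1},A_k,P_{k+1},\dots,P_n]$ is an $n\times n\times n$ alternating sign hypermatrix.
   Context: An $n\times n$ alternating sign matrix (ASM) is a $(0,\pm1)$-matrix whose rows and columns each have nonzeros alternating in sign beginning and ending with $+1$. An $n\times n\times n$ hypermatrix $[A_1,\dots,A_n]$ with horizontal planes $A_s=[a_{ijs}]_{i,j}$ is an alternating sign hypermatrix if every line (fix two indices, vary the third) has nonzeros alternating in sign beginning and ending with $+1$. $\sigma_-(B)$ denotes the number of $-1$ entries of $B$. $F_n^k=[f_{ij}]$ is the $n\times n$ matrix with $f_{ij}=(-1)^{i+j-k-1}$ if $k+1\le i+j\le 2n-k+1$ and $|i-j|\le k-1$, and $f_{ij}=0$ otherwise (an ASM; $\sigma_-(F_n^k)=(k-1)(n-k)$). -}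

module Defs where

open import Data.Nat as ℕ using (ℕ; zero; suc)
open import Data.Integer as ℤ using (ℤ; +_; -[1+_]; 0ℤ; 1ℤ)
open import Data.Fin using (Fin; toℕ; _≟_)
open import Data.Fin.Permutation using (Permutation′; _⟨$⟩ʳ_)
open import Data.List using (List; []; _∷_; filter; allFin; map; concatMap; length)
open import Data.Product using (_×_; ∃)
open import Data.Sum using (_⊎_)
open import Relation.Nullary using (¬_; does)
open import Relation.Binary.PropositionalEquality using (_≡_)
open import Relation.Nullary.Decidable using (¬?)
open import Data.Bool using (if_then_else_; _∧_)
open import Data.Nat using (∣_-_∣)
open import Data.Nat.Properties using ()
open import Data.Integer.Properties using () renaming (_≟_ to _≟ℤ_)

Line : ℕ → Set
Line n = Fin n → ℤ

entries : ∀ {n} → Line n → List ℤ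
entries {n} v = map v (allFin n)

nonzeros : ∀ {n} → Line n → List ℤ
nonzeros v = filter (λ x → ¬? (x ≟ℤ 0ℤ)) (entries v)

data AltFromPlus : List ℤ → Set
data AltFromMinus : List ℤ → Set
data AltFromPlus where
  last : AltFromPlus (1ℤ ∷ [])
  step : ∀ {xs} → AltFromMinus xs → AltFromPlus (1ℤ ∷ xs)
data AltFromMinus where
  step : ∀ {xs} → AltFromPlus xs → AltFromMinus (-[1+ 0 ] ∷ xs)

IsSign : ℤ → Set
IsSign x = (x ≡ 0ℤ) ⊎ (x ≡ 1ℤ) ⊎ (x ≡ -[1+ 0 ])

IsAltLine : ∀ {n} → Line n → Set
IsAltLine v = (∀ i → IsSign (v i)) × AltFromPlus (nonzeros v)

-- n×n matrices, M i j = entry in row i, column j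
Matrix : ℕ → Set
Matrix n = Fin n → Fin n → ℤ

IsASM : ∀ {n} → Matrix n → Set
IsASM M = (∀ i → IsAltLine (λ j → M i j)) × (∀ j → IsAltLine (λ i → M i j))

IsPermutationMatrix : ∀ {n} → Matrix n → Set
IsPermutationMatrix {n} M =
  ∃ λ (π : Permutation′ n) → ∀ i j → M i j ≡ (if does (π ⟨$⟩ʳ i ≟ j) then 1ℤ else 0ℤ)

σ- : ∀ {n} → Matrix n → ℕ
σ- {n} M = length (filter (λ x → x ≟ℤ -[1+ 0 ])
             (concatMap (λ i → map (M i) (allFin n)) (allFin n)))

Hypermatrix : ℕ → Set
Hypermatrix n = Fin n → Fin n → Fin n → ℤ

plane : ∀ {n} → Hypermatrix n → Fin n → Matrix n
plane H s i j = H i j s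

IsASHM : ∀ {n} → Hypermatrix n → Set
IsASHM H = (∀ j s → IsAltLine (λ i → H i j s))
         × (∀ i s → IsAltLine (λ j → H i j s))
         × (∀ i j → IsAltLine (λ s → H i j s))

negOnePow : ℕ → ℤ
negOnePow zero = 1ℤ
negOnePow (suc m) = ℤ.- negOnePow m

F : (n k : ℕ) → Matrix n
F n k i j = let a = suc (toℕ i) ; b = suc (toℕ j) in
  if does (suc k ℕ.≤? (a ℕ.+ b)) ∧ does ((a ℕ.+ b) ℕ.≤? (2 ℕ.* n ℕ.∸ k ℕ.+ 1))
       ∧ does (ℕ.∣ a - b ∣ ℕ.≤? (k ℕ.∸ 1))
  then negOnePow (a ℕ.+ b ℕ.∸ k ℕ.∸ 1) else 0ℤ

{-# OPTIONS --safe #-}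

-- Put p = k - 1 and q = n - k, and look for A + B + C = J with A an ASM and B, C sums of p and q permutation matrices
-- such that every entry is 0 or 1 in B and in C; the vertical lines then alternate automatically.
--
-- A sum of permutation matrices stays one under a 2×2 switch of its entries (recolour along a Kempe chain).  Hence a
-- solution for (p , q) extends to (p + 1 , q): add a row and a column meeting in an entry 1 of A, turn q cells of C in
-- distinct rows and columns into cells of B, and let C occupy these rows and columns on the border and B the others.
-- The cells exist: if A has at most pq entries -1, some permutation matrix of C contains at most p of them.
--
-- To create entries -1, keep the triangle i + j < q (counting from 0) inside C and use the antidiagonal i + j = q - 1
-- for the extension.  Then the corner entry 1 of A moves along row 0 in q switches of C, each of which creates one
-- entry -1 on that antidiagonal, and the triangle is restored at the end.  So every t ≤ pq occurs, and F has at most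
-- pq entries -1.
module Submission where

open import Defs
open import Data.Nat using (ℕ; zero; suc; _+_; _*_; _∸_; _≤_; _<_; z≤n; s≤s; _≤?_; _<?_; ∣_-_∣; s≤s⁻¹; pred) renaming (_≟_ to _≟ℕ_)
open import Data.Nat.Properties hiding (_≟_; suc-injective)
open import Data.Nat.Tactic.RingSolver using (solve-∀)
open import Data.Integer using (ℤ; 0ℤ; 1ℤ; -1ℤ)
open import Data.Integer.Properties using (neg-involutive) renaming (_≟_ to _≟ℤ_)
open import Data.Fin using (Fin; zero; suc; toℕ; fromℕ<; _≟_; punchOut; opposite; _↑ˡ_; _↑ʳ_; splitAt)
open import Data.Fin.Properties using (any?; pigeonhole; punchOut-injective; toℕ-fromℕ<; toℕ<n; toℕ-injective; suc-injective; opposite-prop; opposite-involutive; splitAt-↑ˡ; splitAt-↑ʳ; splitAt⁻¹-↑ʳ; toℕ-↑ʳ)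
open import Data.Fin.Permutation using (Permutation′; permutation; _⟨$⟩ʳ_; _⟨$⟩ˡ_; inverseˡ; inverseʳ; _∘ₚ_; transpose; lift₀; reverse) renaming (id to idₚ)
open import Data.Bool using (Bool; true; false; if_then_else_; _∧_; not)
open import Data.List using (List; []; _++_; filter; map; tabulate; allFin; length; concatMap)
open import Data.List.Properties using (map-tabulate; filter-++; length-++)
open import Data.Product using (_×_; _,_; ∃; ∃₂; proj₁; proj₂)
open import Data.Sum as Sum using (_⊎_; inj₁; inj₂)
open import Function using (_∘_; id)
open import Relation.Nullary using (¬_; Dec; yes; no; does; contradiction)
open import Relation.Nullary.Decidable using (_⊎-dec_; ¬?; dec-true; dec-false)
open import Relation.Unary using (Decidable)
open import Relation.Binary.PropositionalEquality
open import Algebra.Properties.CommutativeMonoid.Sum +-0-commutativeMonoid using (sum; sum-cong-≗; ∑-distrib-+; ∑-comm)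

-- Indicators, permutation matrices and injections of a finite set.

⟦_⟧ : Bool → ℕ
⟦ b ⟧ = if b then 1 else 0

δ : ∀ {n} → Fin n → Fin n → ℕ
δ x y = ⟦ does (x ≟ y) ⟧

δ-refl : ∀ {n} {x y : Fin n} → x ≡ y → δ x y ≡ 1
δ-refl {x = x} {y} eq = cong ⟦_⟧ (dec-true (x ≟ y) eq)

δ-≢ : ∀ {n} {x y : Fin n} → x ≢ y → δ x y ≡ 0
δ-≢ {x = x} {y} neq = cong ⟦_⟧ (dec-false (x ≟ y) neq)

E : ∀ {n} → Fin n → Fin n → Fin n → Fin n → ℕ
E i j x y = δ i x * δ j y

mat : ∀ {n} → Permutation′ n → Fin n → Fin n → ℕ
mat π i j = δ (π ⟨$⟩ʳ i) j

perm-injective : ∀ {n} (π : Permutation′ n) {x y} → π ⟨$⟩ʳ x ≡ π ⟨$⟩ʳ y → x ≡ y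
perm-injective π eq = trans (sym (inverseˡ π)) (trans (cong (π ⟨$⟩ˡ_) eq) (inverseˡ π))

injective⇒surjective : ∀ {n} (f : Fin n → Fin n) → (∀ {x y} → f x ≡ f y → x ≡ y) → ∀ y → ∃ λ x → f x ≡ y
injective⇒surjective {suc n} f inj y with any? (λ x → f x ≟ y)
... | yes hit = hit
... | no miss with pigeonhole (n<1+n n) (λ x → punchOut {i = y} {j = f x} (λ eq → miss (x , sym eq)))
...   | x , x′ , x<x′ , eq = contradiction (cong toℕ (inj (punchOut-injective {i = y} _ _ eq))) (<⇒≢ x<x′)

injective⇒permutation : ∀ {n} (f : Fin n → Fin n) → (∀ {x y} → f x ≡ f y → x ≡ y) → ∃ λ (π : Permutation′ n) → ∀ x → π ⟨$⟩ʳ x ≡ f x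
injective⇒permutation f inj = permutation f (λ y → proj₁ (sur y)) (λ y → proj₂ (sur y)) (λ x → inj (proj₂ (sur (f x)))) , λ _ → refl
  where sur = injective⇒surjective f inj

-- Sums of permutation matrices.

-- The equations are pointwise, so that a matrix can be replaced by an entrywise equal one without
-- function extensionality.
data PermSum {n : ℕ} : ℕ → (Fin n → Fin n → ℕ) → Set where
  []   : ∀ {M} → (∀ i j → M i j ≡ 0) → PermSum 0 M
  cons : ∀ {r M M′} (π : Permutation′ n) → PermSum r M → (∀ i j → M′ i j ≡ mat π i j + M i j) → PermSum (suc r) M′

PermSum-cong : ∀ {n r} {M M′ : Fin n → Fin n → ℕ} → (∀ i j → M′ i j ≡ M i j) → PermSum r M → PermSum r M′
PermSum-cong eq ([] z)       = [] λ i j → trans (eq i j) (z i j)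
PermSum-cong eq (cons π R e) = cons π R λ i j → trans (eq i j) (e i j)

-- A positive entry comes from the 1 of some summand `π`; the order of the summands is immaterial,
-- so `π` can be split off first.
extract : ∀ {n r} {M : Fin n → Fin n → ℕ} {i j} → PermSum r M → 1 ≤ M i j →
  ∃ λ r₀ → ∃ λ π → ∃ λ M₀ → r ≡ suc r₀ × π ⟨$⟩ʳ i ≡ j × PermSum r₀ M₀ × (∀ x y → M x y ≡ mat π x y + M₀ x y)
extract {i = i} {j} ([] z) pos = contradiction (≤-trans pos (≤-reflexive (z i j))) λ ()
extract {i = i} {j} (cons {M = M₀} π R e) pos with (π ⟨$⟩ʳ i) ≟ j
... | yes eq = _ , π , M₀ , refl , eq , R , e
... | no neq with extract R (subst (1 ≤_) (trans (e i j) (cong (_+ M₀ i j) (δ-≢ neq))) pos)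
...   | r₁ , π₁ , M₁ , refl , eq , R₁ , e₁ =
        _ , π₁ , (λ x y → mat π x y + M₁ x y) , refl , eq , cons π R₁ (λ _ _ → refl) ,
        λ x y → trans (e x y) (trans (cong (mat π x y +_) (e₁ x y)) (swap (mat π x y) (mat π₁ x y) (M₁ x y)))
  where
  swap : ∀ a b c → a + (b + c) ≡ b + (a + c)
  swap = solve-∀

-- Kempe chains and 2×2 switches.

least : ∀ {ℓ} {P : ℕ → Set ℓ} → Decidable P → ∀ m → P m → ∃ λ l → P l × (∀ {x} → x < l → ¬ P x)
least P? zero    pm = 0 , pm , λ ()
least P? (suc m) pm with P? 0
... | yes p0 = 0 , p0 , λ ()
... | no ¬p0 with least (P? ∘ suc) m pm
...   | l , pl , min = suc l , pl , λ { {zero} _ → ¬p0 ; {suc x} (s≤s x<l) → min x<l }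

orbit : ∀ {n} → (Fin n → Fin n) → Fin n → ℕ → Fin n
orbit next i zero    = i
orbit next i (suc m) = next (orbit next i m)

-- Two of the first n + 1 points of the orbit coincide, and injectivity cancels the steps before the
-- earlier one.
orbit-returns : ∀ {n} (next : Fin n → Fin n) → (∀ {x y} → next x ≡ next y → x ≡ y) → ∀ i → ∃ λ m → orbit next i (suc m) ≡ i
orbit-returns {n} next inj i with pigeonhole (n<1+n n) (λ x → orbit next i (toℕ x))
... | x , y , x<y , eq with m≤n⇒∃[o]m+o≡n x<y
...   | d , x+d≡y = d , sym (cancel (suc d) (toℕ x) (trans eq (cong (orbit next i) (trans (sym x+d≡y) (sym (+-suc (toℕ x) d))))))
  where
  cancel : ∀ d x → orbit next i x ≡ orbit next i (x + d) → i ≡ orbit next i d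
  cancel d zero    eq = eq
  cancel d (suc x) eq = cancel d x (inj eq)

-- A 2×2 switch whose two cells lie in different summands. The cells given up are added on the left
-- because entries are natural numbers.
record TwoSwap {n} (σ τ : Permutation′ n) (i i′ : Fin n) : Set where
  field
    σ′ τ′ : Permutation′ n
    eqn : ∀ x y → mat σ′ x y + mat τ′ x y + (E i (σ ⟨$⟩ʳ i) x y + E i′ (τ ⟨$⟩ʳ i′) x y)
                ≡ mat σ x y + mat τ x y + (E i (τ ⟨$⟩ʳ i′) x y + E i′ (σ ⟨$⟩ʳ i) x y)

-- The alternating path in the union of two perfect matchings between rows and columns: along `σ` to
-- a column, then back along `τ` to the next row.
chainRow : ∀ {n} → Permutation′ n → Permutation′ n → Fin n → ℕ → Fin n
chainRow σ τ = orbit (λ x → τ ⟨$⟩ˡ (σ ⟨$⟩ʳ x))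

-- The rows strictly between i and the first later row end ∈ {i , i′} on the orbit of i under τ⁻¹σ exchange
-- their two entries; row i then receives the entries of τ in rows end and opp, and row i′ the entry σ i.
module KempeChain {n : ℕ} (σ τ : Permutation′ n) (i i′ : Fin n) (i≢i′ : i ≢ i′) (l : ℕ) (opp : Fin n)
  (end-opp : (chainRow σ τ i (suc l) ≡ i × opp ≡ i′) ⊎ (chainRow σ τ i (suc l) ≡ i′ × opp ≡ i))
  (noHit : ∀ {m} → m < l → ¬ (chainRow σ τ i (suc m) ≡ i ⊎ chainRow σ τ i (suc m) ≡ i′)) where

  private
    r : ℕ → Fin n
    r = chainRow σ τ i

    s t next : Fin n → Fin n
    s x = σ ⟨$⟩ʳ x
    t x = τ ⟨$⟩ʳ x
    next x = τ ⟨$⟩ˡ (s x)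

    t-next : ∀ x → t (next x) ≡ s x
    t-next x = inverseʳ τ

    s≡t⇒next : ∀ {x y} → s x ≡ t y → y ≡ next x
    s≡t⇒next eq = perm-injective τ (trans (sym eq) (sym (t-next _)))

    next-inj : ∀ {x y} → next x ≡ next y → x ≡ y
    next-inj {x} {y} eq = perm-injective σ (trans (sym (t-next x)) (trans (cong t eq) (t-next y)))

    end : Fin n
    end = r (suc l)

    hit : end ≡ i ⊎ end ≡ i′
    hit = Sum.map proj₁ proj₁ end-opp

    opp-cases : opp ≡ i ⊎ opp ≡ i′
    opp-cases = Sum.swap (Sum.map proj₂ proj₂ end-opp)

    opp≢end : opp ≢ end
    opp≢end eq = Sum.[ (λ (e , o) → i≢i′ (trans (sym e) (trans (sym eq) o)))
                     , (λ (e , o) → i≢i′ (trans (sym o) (trans eq e))) ] end-opp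

    Inside : Fin n → Set
    Inside x = ∃ λ (m : Fin l) → r (suc (toℕ m)) ≡ x

    inside : ∀ {m x} → m < l → r (suc m) ≡ x → Inside x
    inside m<l eq = fromℕ< m<l , trans (cong (λ k → r (suc k)) (toℕ-fromℕ< m<l)) eq

    data Class (x : Fin n) : Set where
      ins   : Inside x → Class x
      isI   : ¬ Inside x → x ≡ i → Class x
      isI′  : ¬ Inside x → x ≡ i′ → Class x
      other : ¬ Inside x → x ≢ i → x ≢ i′ → Class x

    classify : ∀ x → Class x
    classify x with any? (λ (m : Fin l) → r (suc (toℕ m)) ≟ x)
    ... | yes p = ins p
    ... | no ¬p with x ≟ i | x ≟ i′
    ...   | yes e | _ = isI ¬p e
    ...   | no _  | yes e = isI′ ¬p e
    ...   | no ¬e | no ¬e′ = other ¬p ¬e ¬e′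

    inside⇒noHit : ∀ {x} → Inside x → ¬ (x ≡ i ⊎ x ≡ i′)
    inside⇒noHit (m , refl) = noHit (toℕ<n m)

    pred-of : ∀ m y → m ≤ l → r (suc m) ≡ next y → Inside y ⊎ y ≡ i
    pred-of zero    y m≤l eq = inj₂ (sym (next-inj eq))
    pred-of (suc m) y m≤l eq = inj₁ (inside m≤l (next-inj eq))

    succ-of : ∀ m → m ≤ l → Inside (r (suc m)) ⊎ r (suc m) ≡ end
    succ-of m m≤l with m≤n⇒m<n∨m≡n m≤l
    ... | inj₁ m<l = inj₁ (inside m<l refl)
    ... | inj₂ refl = inj₂ refl

    -- `f` becomes the new `σ` and `g` the new `τ`. In row `i` both take columns of `τ`, because the
    -- column `σ i` passes to row `i′`.
    f : ∀ {x} → Class x → Fin n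
    f {x} (ins _)       = t x
    f {x} (isI _ _)     = t end
    f {x} (isI′ _ _)    = s x
    f {x} (other _ _ _) = s x

    g : ∀ {x} → Class x → Fin n
    g {x} (ins _)       = s x
    g {x} (isI _ _)     = t opp
    g {x} (isI′ _ _)    = s i
    g {x} (other _ _ _) = t x

    end-not-inside : ∀ {x} → Inside x → x ≢ end
    end-not-inside p refl = inside⇒noHit p hit

    opp-not-inside : ¬ Inside opp
    opp-not-inside p = inside⇒noHit p opp-cases

    -- The column that `τ` gives to a row of the chain is the one that `σ` gives to the preceding
    -- row, and this row is inside or is `i`.
    ins≢σ : ∀ {x y} → Inside x → ¬ Inside y → y ≢ i → t x ≢ s y
    ins≢σ {x} {y} (m , refl) ¬p y≢i eq with pred-of (toℕ m) y (<⇒≤ (toℕ<n m)) (s≡t⇒next (sym eq))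
    ... | inj₁ p = ¬p p
    ... | inj₂ e = y≢i e

    end≢σ : ∀ {y} → ¬ Inside y → y ≢ i → t end ≢ s y
    end≢σ {y} ¬p y≢i eq with pred-of l y ≤-refl (s≡t⇒next (sym eq))
    ... | inj₁ p = ¬p p
    ... | inj₂ e = y≢i e

    next-inside : ∀ {x} → (Inside x ⊎ x ≡ i) → Inside (next x) ⊎ next x ≡ end
    next-inside (inj₁ (m , refl)) = succ-of (suc (toℕ m)) (toℕ<n m)
    next-inside (inj₂ refl) = succ-of 0 z≤n

    -- The column `s x` is the `τ`-column of `next x` only, and the chain leads from `x` to a row
    -- that is inside or is `end`.
    τ≢ : ∀ {x y} → (Inside x ⊎ x ≡ i) → ¬ Inside y → y ≢ end → s x ≢ t y
    τ≢ {x} {y} px ¬p y≢end eq with next-inside px | s≡t⇒next eq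
    ... | inj₁ p | refl = ¬p p
    ... | inj₂ e | refl = y≢end e

    other≢end : ∀ {x} → x ≢ i → x ≢ i′ → x ≢ end
    other≢end x≢i x≢i′ refl with hit
    ... | inj₁ e = x≢i e
    ... | inj₂ e = x≢i′ e

    other≢opp : ∀ {x} → x ≢ i → x ≢ i′ → x ≢ opp
    other≢opp x≢i x≢i′ eq with opp-cases
    ... | inj₁ e = x≢i (trans eq e)
    ... | inj₂ e = x≢i′ (trans eq e)

    i′≢i : ∀ {x} → x ≡ i′ → x ≢ i
    i′≢i e e′ = i≢i′ (trans (sym e′) e)

    f-inj : ∀ {x y} (cx : Class x) (cy : Class y) → f cx ≡ f cy → x ≡ y
    f-inj (ins p) (ins p′) eq = perm-injective τ eq
    f-inj (ins p) (isI _ _) eq = contradiction (perm-injective τ eq) (end-not-inside p)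
    f-inj (ins p) (isI′ ¬p e) eq = contradiction eq (ins≢σ p ¬p (i′≢i e))
    f-inj (ins p) (other ¬p e _) eq = contradiction eq (ins≢σ p ¬p e)
    f-inj (isI _ _) (ins p) eq = contradiction (perm-injective τ (sym eq)) (end-not-inside p)
    f-inj (isI _ e) (isI _ e′) eq = trans e (sym e′)
    f-inj (isI _ _) (isI′ ¬p e) eq = contradiction eq (end≢σ ¬p (i′≢i e))
    f-inj (isI _ _) (other ¬p e _) eq = contradiction eq (end≢σ ¬p e)
    f-inj (isI′ ¬p e) (ins p) eq = contradiction (sym eq) (ins≢σ p ¬p (i′≢i e))
    f-inj (isI′ ¬p e) (isI _ _) eq = contradiction (sym eq) (end≢σ ¬p (i′≢i e))
    f-inj (isI′ _ _) (isI′ _ _) eq = perm-injective σ eq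
    f-inj (isI′ _ _) (other _ _ _) eq = perm-injective σ eq
    f-inj (other ¬p e _) (ins p) eq = contradiction (sym eq) (ins≢σ p ¬p e)
    f-inj (other ¬p e _) (isI _ _) eq = contradiction (sym eq) (end≢σ ¬p e)
    f-inj (other _ _ _) (isI′ _ _) eq = perm-injective σ eq
    f-inj (other _ _ _) (other _ _ _) eq = perm-injective σ eq

    ins≢i : ∀ {x} → Inside x → x ≢ i
    ins≢i p e = inside⇒noHit p (inj₁ e)

    g-inj : ∀ {x y} (cx : Class x) (cy : Class y) → g cx ≡ g cy → x ≡ y
    g-inj (ins p) (ins p′) eq = perm-injective σ eq
    g-inj (ins p) (isI _ _) eq = contradiction eq (τ≢ (inj₁ p) opp-not-inside opp≢end)
    g-inj (ins p) (isI′ _ _) eq = contradiction (perm-injective σ eq) (ins≢i p)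
    g-inj (ins p) (other ¬p e e′) eq = contradiction eq (τ≢ (inj₁ p) ¬p (other≢end e e′))
    g-inj (isI _ _) (ins p) eq = contradiction (sym eq) (τ≢ (inj₁ p) opp-not-inside opp≢end)
    g-inj (isI _ e) (isI _ e′) eq = trans e (sym e′)
    g-inj (isI _ _) (isI′ _ _) eq = contradiction (sym eq) (τ≢ (inj₂ refl) opp-not-inside opp≢end)
    g-inj (isI _ _) (other _ e e′) eq = contradiction (perm-injective τ (sym eq)) (other≢opp e e′)
    g-inj (isI′ _ _) (ins p) eq = contradiction (perm-injective σ (sym eq)) (ins≢i p)
    g-inj (isI′ _ _) (isI _ _) eq = contradiction eq (τ≢ (inj₂ refl) opp-not-inside opp≢end)
    g-inj (isI′ _ e) (isI′ _ e′) eq = trans e (sym e′)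
    g-inj (isI′ _ _) (other ¬p e e′) eq = contradiction eq (τ≢ (inj₂ refl) ¬p (other≢end e e′))
    g-inj (other ¬p e e′) (ins p) eq = contradiction (sym eq) (τ≢ (inj₁ p) ¬p (other≢end e e′))
    g-inj (other _ e e′) (isI _ _) eq = contradiction (perm-injective τ eq) (other≢opp e e′)
    g-inj (other ¬p e e′) (isI′ _ _) eq = contradiction (sym eq) (τ≢ (inj₂ refl) ¬p (other≢end e e′))
    g-inj (other _ _ _) (other _ _ _) eq = perm-injective τ eq

    away : ∀ {x} y j j′ → x ≢ i → x ≢ i′ → E i j x y + E i′ j′ x y ≡ 0
    away _ _ _ x≢i x≢i′ rewrite δ-≢ (x≢i ∘ sym) | δ-≢ (x≢i′ ∘ sym) = refl

    at-i : ∀ y j j′ → E i j i y + E i′ j′ i y ≡ δ j y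
    at-i _ _ _ rewrite δ-refl (refl {x = i}) | δ-≢ (i≢i′ ∘ sym) = trans (+-identityʳ _) (+-identityʳ _)

    at-i′ : ∀ y j j′ → E i j i′ y + E i′ j′ i′ y ≡ δ j′ y
    at-i′ _ _ _ rewrite δ-refl (refl {x = i′}) | δ-≢ i≢i′ = +-identityʳ _

    unchanged : ∀ {x} y → x ≢ i → x ≢ i′ → E i (s i) x y + E i′ (t i′) x y ≡ E i (t i′) x y + E i′ (s i) x y
    unchanged y x≢i x≢i′ = trans (away y (s i) (t i′) x≢i x≢i′) (sym (away y (t i′) (s i) x≢i x≢i′))

    -- Inside rows merely exchange their two columns. Row `i` receives the `τ`-columns of rows `i`
    -- and `i′`, in an order that depends on where the chain ends; row `i′` keeps `σ i′` and trades
    -- `τ i′` for `σ i`.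
    rows : ∀ {x} (cx : Class x) y →
      δ (f cx) y + δ (g cx) y + (E i (s i) x y + E i′ (t i′) x y) ≡ δ (s x) y + δ (t x) y + (E i (t i′) x y + E i′ (s i) x y)
    rows {x} (ins p) y = cong₂ _+_ (+-comm (δ (t x) y) (δ (s x) y)) (unchanged y (ins≢i p) (λ e → inside⇒noHit p (inj₂ e)))
    rows (isI _ refl) y = trans (cong (δ (t end) y + δ (t opp) y +_) (at-i y (s i) (t i′)))
                          (trans (ends end-opp) (cong (δ (s i) y + δ (t i) y +_) (sym (at-i y (t i′) (s i)))))
      where
      perm₁ : ∀ u v w → u + v + w ≡ w + u + v
      perm₁ = solve-∀
      perm₂ : ∀ u v w → u + v + w ≡ w + v + u
      perm₂ = solve-∀
      ends : (end ≡ i × opp ≡ i′) ⊎ (end ≡ i′ × opp ≡ i) → δ (t end) y + δ (t opp) y + δ (s i) y ≡ δ (s i) y + δ (t i) y + δ (t i′) y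
      ends (inj₁ (e , o)) = trans (cong₂ (λ u v → δ (t u) y + δ (t v) y + δ (s i) y) e o) (perm₁ (δ (t i) y) (δ (t i′) y) (δ (s i) y))
      ends (inj₂ (e , o)) = trans (cong₂ (λ u v → δ (t u) y + δ (t v) y + δ (s i) y) e o) (perm₂ (δ (t i′) y) (δ (t i) y) (δ (s i) y))
    rows (isI′ _ refl) y = trans (cong (δ (s i′) y + δ (s i) y +_) (at-i′ y (s i) (t i′)))
                          (trans (perm₃ (δ (s i′) y) (δ (s i) y) (δ (t i′) y)) (cong (δ (s i′) y + δ (t i′) y +_) (sym (at-i′ y (t i′) (s i)))))
      where
      perm₃ : ∀ u v w → u + v + w ≡ u + w + v
      perm₃ = solve-∀
    rows {x} (other _ x≢i x≢i′) y = cong (δ (s x) y + δ (t x) y +_) (unchanged y x≢i x≢i′)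

  kempe : TwoSwap σ τ i i′
  kempe = record
    { σ′ = proj₁ σ̂
    ; τ′ = proj₁ τ̂
    ; eqn = λ x y → trans (cong (_+ (E i (s i) x y + E i′ (t i′) x y)) (cong₂ (λ u v → δ u y + δ v y) (proj₂ σ̂ x) (proj₂ τ̂ x))) (rows (classify x) y)
    }
    where
    σ̂ = injective⇒permutation (λ x → f (classify x)) (λ {x} {y} → f-inj (classify x) (classify y))
    τ̂ = injective⇒permutation (λ x → g (classify x)) (λ {x} {y} → g-inj (classify x) (classify y))

twoSwap : ∀ {n} (σ τ : Permutation′ n) (i i′ : Fin n) → i ≢ i′ → TwoSwap σ τ i i′
twoSwap {n} σ τ i i′ i≢i′ with orbit-returns next next-inj i
  where
  next : Fin n → Fin n
  next x = τ ⟨$⟩ˡ (σ ⟨$⟩ʳ x)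
  next-inj : ∀ {x y} → next x ≡ next y → x ≡ y
  next-inj eq = perm-injective σ (trans (sym (inverseʳ τ)) (trans (cong (τ ⟨$⟩ʳ_) eq) (inverseʳ τ)))
-- The orbit returns to `i`, so a first visit to `i` or `i′` exists; being the first, it has neither
-- row strictly before it. `opp` is the row of the two that was not reached.
... | m , back with least (λ m → (chainRow σ τ i (suc m) ≟ i) ⊎-dec (chainRow σ τ i (suc m) ≟ i′)) m (inj₁ back)
...   | l , inj₁ e , min = KempeChain.kempe σ τ i i′ i≢i′ l i′ (inj₁ (e , refl)) min
...   | l , inj₂ e , min = KempeChain.kempe σ τ i i′ i≢i′ l i (inj₂ (e , refl)) min

-- If one summand contains both cells, exchanging its rows `i` and `i′` suffices; if they lie in two
-- summands, a Kempe chain between these does it.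
switch : ∀ {n r} {M : Fin n → Fin n → ℕ} {i i′ j j′} → i ≢ i′ → PermSum r M → 1 ≤ M i j′ → 1 ≤ M i′ j →
  ∃ λ M′ → PermSum r M′ × (∀ x y → M′ x y + (E i j′ x y + E i′ j x y) ≡ M x y + (E i j x y + E i′ j′ x y))
switch {M = M} {i} {i′} {j} {j′} i≢i′ R pos pos′ with extract R pos
... | r₀ , σ , M₀ , refl , refl , R₀ , e₀ with σ ⟨$⟩ʳ i′ ≟ j
...   | yes refl = _ , cons (transpose i i′ ∘ₚ σ) R₀ (λ _ _ → refl) , λ x y →
          trans (shift (mat (transpose i i′ ∘ₚ σ) x y) (M₀ x y) _)
            (trans (cong (_+ M₀ x y) (row x y)) (trans (sym (shift (mat σ x y) (M₀ x y) _)) (cong (_+ _) (sym (e₀ x y)))))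
  where
  shift : ∀ u v w → u + v + w ≡ u + w + v
  shift = solve-∀
  row : ∀ x y → mat (transpose i i′ ∘ₚ σ) x y + (E i (σ ⟨$⟩ʳ i) x y + E i′ (σ ⟨$⟩ʳ i′) x y) ≡ mat σ x y + (E i (σ ⟨$⟩ʳ i′) x y + E i′ (σ ⟨$⟩ʳ i) x y)
  row x y with x ≟ i
  ... | yes refl rewrite δ-refl (refl {x = x}) | δ-≢ (i≢i′ ∘ sym) = swap′ (δ (σ ⟨$⟩ʳ i′) y) (δ (σ ⟨$⟩ʳ i) y)
    where
    swap′ : ∀ u v → u + (1 * v + 0 * u) ≡ v + (1 * u + 0 * v)
    swap′ = solve-∀
  ... | no x≢i with x ≟ i′
  ...   | yes refl rewrite δ-refl (refl {x = x}) | δ-≢ i≢i′ = swap′ (δ (σ ⟨$⟩ʳ i) y) (δ (σ ⟨$⟩ʳ i′) y)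
    where
    swap′ : ∀ u v → u + (0 * u + 1 * v) ≡ v + (0 * v + 1 * u)
    swap′ = solve-∀
  ...   | no x≢i′ rewrite δ-≢ (x≢i ∘ sym) | δ-≢ (x≢i′ ∘ sym) = refl
-- Here `σ` avoids the cell `(i′ , j)`, which is therefore still positive in the remainder and lies
-- in a second summand `τ`.
switch {i = i} {i′} {j} {j′} i≢i′ R pos pos′ | r₀ , σ , M₀ , refl , refl , R₀ , e₀ | no neq
  with extract {i = i′} {j} R₀ (subst (1 ≤_) (trans (e₀ i′ j) (cong (_+ M₀ i′ j) (δ-≢ neq))) pos′)
... | r₁ , τ , M₁ , refl , refl , R₁ , e₁ = _ , cons σ′ (cons τ′ R₁ (λ _ _ → refl)) (λ _ _ → refl) , λ x y →
        trans (shift (mat σ′ x y) (mat τ′ x y) (M₁ x y) _)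
          (trans (cong (_+ M₁ x y) (eqn x y)) (trans (sym (shift (mat σ x y) (mat τ x y) (M₁ x y) _))
            (cong (_+ _) (sym (trans (e₀ x y) (cong (mat σ x y +_) (e₁ x y)))))))
  where
  open TwoSwap (twoSwap σ τ i i′ i≢i′)
  shift : ∀ u v w z → u + (v + w) + z ≡ u + v + z + w
  shift = solve-∀

-- Bordering a sum of permutation matrices.

sum-zero : ∀ {n} (f : Fin n → ℕ) → (∀ x → f x ≡ 0) → sum f ≡ 0
sum-zero {zero}  f z = refl
sum-zero {suc n} f z = cong₂ _+_ (z zero) (sum-zero (f ∘ suc) (z ∘ suc))

sum-single : ∀ {n} (f : Fin n → ℕ) i → (∀ x → x ≢ i → f x ≡ 0) → sum f ≡ f i
sum-single f zero    z = trans (cong (f zero +_) (sum-zero (f ∘ suc) (λ x → z (suc x) λ ()))) (+-identityʳ _)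
sum-single f (suc i) z = cong₂ _+_ (z zero λ ()) (sum-single (f ∘ suc) i (λ x x≢i → z (suc x) (x≢i ∘ suc-injective)))

∑∑E≡1 : ∀ {n} (i j : Fin n) → sum (λ x → sum (λ y → E i j x y)) ≡ 1
∑∑E≡1 i j = trans (sum-single _ i (λ x x≢i → sum-zero _ λ y → cong (_* δ j y) (δ-≢ (x≢i ∘ sym))))
  (trans (sum-single _ j (λ y y≢j → trans (cong (δ i i *_) (δ-≢ (y≢j ∘ sym))) (*-zeroʳ (δ i i))))
         (cong₂ _*_ (δ-refl (refl {x = i})) (δ-refl (refl {x = j}))))

corner : ∀ {n} → ℕ → (Fin n → Fin n → ℕ) → Fin (suc n) → Fin (suc n) → ℕ
corner r M zero    zero    = r
corner r M zero    (suc _) = 0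
corner r M (suc _) zero    = 0
corner r M (suc i) (suc j) = M i j

-- Every summand is extended by the fixed point 0, so all `r` of them meet in the corner.
PermSum-corner : ∀ {n r} {M : Fin n → Fin n → ℕ} → PermSum r M → PermSum r (corner r M)
PermSum-corner ([] z) = [] λ where
  zero    zero    → refl
  zero    (suc _) → refl
  (suc _) zero    → refl
  (suc i) (suc j) → z i j
PermSum-corner (cons π R e) = cons (lift₀ π) (PermSum-corner R) λ where
  zero    zero    → refl
  zero    (suc _) → refl
  (suc _) zero    → refl
  (suc i) (suc j) → e i j

-- Each selected x trades the cells (0,0) and (ρ x , κ x) of the inner block for the border cells in row ρ x and column κ x.
cornerSwitches : ∀ {n r N} {M : Fin (suc n) → Fin (suc n) → ℕ} (ρ κ : Fin N → Fin n) (s : Fin N → Bool) →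
  (∀ {x y} → ρ x ≡ ρ y → x ≡ y) → PermSum r M → (∀ x → s x ≡ true → 1 ≤ M (suc (ρ x)) (suc (κ x))) → sum (⟦_⟧ ∘ s) ≤ M zero zero →
  ∃ λ M′ → PermSum r M′ × (∀ i j → M′ i j + sum (λ x → ⟦ s x ⟧ * (E zero zero i j + E (suc (ρ x)) (suc (κ x)) i j))
                              ≡ M i j + sum (λ x → ⟦ s x ⟧ * (E zero (suc (κ x)) i j + E (suc (ρ x)) zero i j)))
cornerSwitches {N = zero} ρ κ s inj R pos bound = _ , R , λ _ _ → refl
cornerSwitches {N = suc N} {M} ρ κ s inj R pos bound
  with cornerSwitches (ρ ∘ suc) (κ ∘ suc) (s ∘ suc) (suc-injective ∘ inj) R (pos ∘ suc) (≤-trans (m≤n+m _ ⟦ s zero ⟧) bound)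
... | M₁ , R₁ , e₁ with s zero | pos zero
...   | false | _ = M₁ , R₁ , e₁
...   | true  | pos₀ with switch {i = zero} {suc (ρ zero)} {suc (κ zero)} {zero} (λ ()) R₁ corner≥1 cell≥1
  where
  tail = sum (⟦_⟧ ∘ s ∘ suc)
  -- The earlier switches have lowered the corner by at most `tail`, and `bound` leaves one unit for
  -- the present switch.
  corner≥1 : 1 ≤ M₁ zero zero
  corner≥1 = +-cancelʳ-≤ tail 1 _ (≤-trans bound (≤-trans (m≤m+n (M zero zero) _) (≤-reflexive
    (trans (sym (e₁ zero zero)) (cong (M₁ zero zero +_) (sum-cong-≗ (λ x → *-identityʳ ⟦ s (suc x) ⟧)))))))
  -- Since `ρ` is injective, no earlier switch has removed a cell from this row of the inner block.
  cell≥1 : 1 ≤ M₁ (suc (ρ zero)) (suc (κ zero))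
  cell≥1 = ≤-trans (pos₀ refl) (≤-trans (m≤m+n _ _) (≤-reflexive (trans (sym (e₁ _ _))
    (trans (cong (M₁ _ _ +_) (sum-zero _ λ x → trans (cong (λ d → ⟦ s (suc x) ⟧ * (d * _)) (δ-≢ {x = ρ (suc x)} {ρ zero} λ eq → contradiction (inj eq) λ ()))
      (*-zeroʳ ⟦ s (suc x) ⟧))) (+-identityʳ _)))))
...     | M₂ , R₂ , e₂ = M₂ , R₂ , λ i j → combine (M₂ i j) _ _ (M₁ i j) _ (M i j) _ (e₂ i j) (e₁ i j)
  where
  combine : ∀ m₂ u U m₁ v m W → m₂ + u ≡ m₁ + v → m₁ + U ≡ m + W → m₂ + (1 * u + U) ≡ m + (1 * v + W)
  combine m₂ u U m₁ v m W p q = trans (lem₁ m₂ u U) (trans (cong (_+ U) p) (trans (lem₂ m₁ v U) (trans (cong (_+ v) q) (lem₃ m W v))))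
    where
    lem₁ : ∀ a b c → a + (1 * b + c) ≡ a + b + c
    lem₁ = solve-∀
    lem₂ : ∀ a b c → a + b + c ≡ a + c + b
    lem₂ = solve-∀
    lem₃ : ∀ a b c → a + b + c ≡ a + (1 * c + b)
    lem₃ = solve-∀

-- Exactly `r` cells of `π` are selected, so pushing them all to the border lowers the corner of the
-- block matrix from `r` to 0. The role of `π` is to keep the selected cells in distinct rows and
-- columns.
prolong : ∀ {n r} {M : Fin n → Fin n → ℕ} {N : Fin (suc n) → Fin (suc n) → ℕ} (π : Permutation′ n) (w : Fin n → Bool) →
  PermSum r M → sum (⟦_⟧ ∘ w) ≡ r → (∀ i → w i ≡ true → 1 ≤ M i (π ⟨$⟩ʳ i)) →
  N zero zero ≡ 0 → (∀ j → N zero (suc j) ≡ ⟦ w (π ⟨$⟩ˡ j) ⟧) → (∀ i → N (suc i) zero ≡ ⟦ w i ⟧) →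
  (∀ i j → N (suc i) (suc j) + ⟦ w i ⟧ * mat π i j ≡ M i j) → PermSum r N
prolong {n} {r} {M} {N} π w R total pos e₀₀ e₀ⱼ eᵢ₀ eᵢⱼ
  with cornerSwitches id (π ⟨$⟩ʳ_) w id (PermSum-corner R) pos (≤-reflexive total)
... | M′ , R′ , e = PermSum-cong N≡M′ R′
  where
  N≡M′ : ∀ i j → N i j ≡ M′ i j
  N≡M′ zero zero = trans e₀₀ (sym (+-cancelʳ-≡ r (M′ zero zero) 0 (begin
    M′ zero zero + r                           ≡⟨ cong (M′ zero zero +_) (trans (sym total) (sum-cong-≗ λ x → sym (*-identityʳ ⟦ w x ⟧))) ⟩
    M′ zero zero + sum (λ x → ⟦ w x ⟧ * 1)     ≡⟨ e zero zero ⟩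
    r + sum (λ x → ⟦ w x ⟧ * 0)                ≡⟨ cong (r +_) (sum-zero (λ x → ⟦ w x ⟧ * 0) λ x → *-zeroʳ ⟦ w x ⟧) ⟩
    r + 0                                      ≡⟨ +-identityʳ r ⟩
    r                                          ∎)))
    where open ≡-Reasoning
  N≡M′ zero (suc j) = trans (e₀ⱼ j) (sym (begin
    M′ zero (suc j)                                        ≡⟨ +-identityʳ _ ⟨
    M′ zero (suc j) + 0                                    ≡⟨ cong (M′ zero (suc j) +_) (sum-zero (λ x → ⟦ w x ⟧ * 0) λ x → *-zeroʳ ⟦ w x ⟧) ⟨
    M′ zero (suc j) + sum (λ x → ⟦ w x ⟧ * 0)              ≡⟨ e zero (suc j) ⟩
    sum (λ x → ⟦ w x ⟧ * (1 * δ (π ⟨$⟩ʳ x) j + 0))         ≡⟨ sum-single _ (π ⟨$⟩ˡ j) (λ x x≢ → trans (cong (λ d → ⟦ w x ⟧ * (1 * d + 0)) (δ-≢ λ eq → x≢ (trans (sym (inverseˡ π)) (cong (π ⟨$⟩ˡ_) eq)))) (*-zeroʳ ⟦ w x ⟧)) ⟩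
    ⟦ w (π ⟨$⟩ˡ j) ⟧ * (1 * mat π (π ⟨$⟩ˡ j) j + 0)        ≡⟨ cong (λ d → ⟦ w (π ⟨$⟩ˡ j) ⟧ * (1 * d + 0)) (δ-refl (inverseʳ π)) ⟩
    ⟦ w (π ⟨$⟩ˡ j) ⟧ * 1                                   ≡⟨ *-identityʳ _ ⟩
    ⟦ w (π ⟨$⟩ˡ j) ⟧                                       ∎))
    where open ≡-Reasoning
  N≡M′ (suc i) zero = trans (eᵢ₀ i) (sym (begin
    M′ (suc i) zero                                        ≡⟨ +-identityʳ _ ⟨
    M′ (suc i) zero + 0                                    ≡⟨ cong (M′ (suc i) zero +_) (sum-zero _ λ x → trans (cong (⟦ w x ⟧ *_) (*-zeroʳ (δ x i))) (*-zeroʳ ⟦ w x ⟧)) ⟨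
    M′ (suc i) zero + sum (λ x → ⟦ w x ⟧ * (δ x i * 0))    ≡⟨ e (suc i) zero ⟩
    sum (λ x → ⟦ w x ⟧ * (δ x i * 1))                      ≡⟨ sum-single _ i (λ x x≢ → trans (cong (λ d → ⟦ w x ⟧ * (d * 1)) (δ-≢ x≢)) (*-zeroʳ ⟦ w x ⟧)) ⟩
    ⟦ w i ⟧ * (δ i i * 1)                                  ≡⟨ cong (λ d → ⟦ w i ⟧ * (d * 1)) (δ-refl {x = i} refl) ⟩
    ⟦ w i ⟧ * 1                                            ≡⟨ *-identityʳ _ ⟩
    ⟦ w i ⟧                                                ∎))
    where open ≡-Reasoning
  N≡M′ (suc i) (suc j) = +-cancelʳ-≡ (⟦ w i ⟧ * mat π i j) _ _ (trans (eᵢⱼ i j) (sym (begin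
    M′ (suc i) (suc j) + ⟦ w i ⟧ * mat π i j                        ≡⟨ cong (λ d → M′ (suc i) (suc j) + ⟦ w i ⟧ * d) (sym (trans (cong (_* mat π i j) (δ-refl {x = i} refl)) (*-identityˡ (mat π i j)))) ⟩
    M′ (suc i) (suc j) + ⟦ w i ⟧ * (δ i i * mat π i j)              ≡⟨ cong (M′ (suc i) (suc j) +_) (sum-single (λ x → ⟦ w x ⟧ * (δ x i * mat π x j)) i (λ x x≢ → trans (cong (λ d → ⟦ w x ⟧ * (d * mat π x j)) (δ-≢ x≢)) (*-zeroʳ ⟦ w x ⟧))) ⟨
    M′ (suc i) (suc j) + sum (λ x → ⟦ w x ⟧ * (δ x i * mat π x j))  ≡⟨ e (suc i) (suc j) ⟩
    M i j + sum (λ x → ⟦ w x ⟧ * (δ x i * 0))                       ≡⟨ cong (M i j +_) (sum-zero _ λ x → trans (cong (⟦ w x ⟧ *_) (*-zeroʳ (δ x i))) (*-zeroʳ ⟦ w x ⟧)) ⟩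
    M i j + 0                                                       ≡⟨ +-identityʳ _ ⟩
    M i j                                                           ∎)))
    where open ≡-Reasoning

-- Alternating lines

data Sgn : Set where
  pos zer neg : Sgn

-- The Boolean is the state before the line is read: `false` if the next nonzero must be +1, `true`
-- if it must be -1 or there is none. An alternating sign line is thus `Alt false`; since `end`
-- requires `true`, the last nonzero is +1.
data Alt : ∀ {n} → Bool → (Fin n → Sgn) → Set where
  end   : ∀ {v} → Alt {0} true v
  skip  : ∀ {n b v} → v zero ≡ zer → Alt {n} b (v ∘ suc) → Alt b v
  plus  : ∀ {n v} → v zero ≡ pos → Alt {n} true (v ∘ suc) → Alt false v
  minus : ∀ {n v} → v zero ≡ neg → Alt {n} false (v ∘ suc) → Alt true v

Alt-cong : ∀ {n b} {v w : Fin n → Sgn} → (∀ x → w x ≡ v x) → Alt b v → Alt b w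
Alt-cong eq end         = end
Alt-cong eq (skip e A)  = skip (trans (eq zero) e) (Alt-cong (eq ∘ suc) A)
Alt-cong eq (plus e A)  = plus (trans (eq zero) e) (Alt-cong (eq ∘ suc) A)
Alt-cong eq (minus e A) = minus (trans (eq zero) e) (Alt-cong (eq ∘ suc) A)

Alt-zero : ∀ {n} {v : Fin n → Sgn} → (∀ x → v x ≡ zer) → Alt true v
Alt-zero {zero}  z = end
Alt-zero {suc n} z = skip (z zero) (Alt-zero (z ∘ suc))

Alt-single : ∀ {n} {v : Fin n → Sgn} x → v x ≡ pos → (∀ y → y ≢ x → v y ≡ zer) → Alt false v
Alt-single zero    e z = plus e (Alt-zero λ y → z (suc y) λ ())
Alt-single (suc x) e z = skip (z zero λ ()) (Alt-single x e λ y y≢ → z (suc y) (y≢ ∘ suc-injective))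

toward : Bool → Sgn
toward true  = pos
toward false = neg

-- `toward b` is the sign that leads from state `not b` to `b`. Up to `y` the old line stays in
-- state `b`, so the two lines agree in state from there on.
Alt-insert : ∀ {n b} {v w : Fin n → Sgn} y → Alt b v → (∀ x → toℕ x ≤ toℕ y → v x ≡ zer) →
  w y ≡ toward b → (∀ x → x ≢ y → w x ≡ v x) → Alt (not b) w
Alt-insert zero (skip {b = true} _ A)  z e same = plus e (Alt-cong (λ x → same (suc x) λ ()) A)
Alt-insert zero (skip {b = false} _ A) z e same = minus e (Alt-cong (λ x → same (suc x) λ ()) A)
Alt-insert zero (plus e′ _)  z _ _ = contradiction (trans (sym (z zero z≤n)) e′) λ ()
Alt-insert zero (minus e′ _) z _ _ = contradiction (trans (sym (z zero z≤n)) e′) λ ()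
Alt-insert (suc y) (skip e′ A) z e same =
  skip (trans (same zero λ ()) e′) (Alt-insert y A (λ x x≤y → z (suc x) (s≤s x≤y)) e (λ x x≢y → same (suc x) (x≢y ∘ suc-injective)))
Alt-insert (suc y) (plus e′ _)  z _ _ = contradiction (trans (sym (z zero z≤n)) e′) λ ()
Alt-insert (suc y) (minus e′ _) z _ _ = contradiction (trans (sym (z zero z≤n)) e′) λ ()

-- A +1 followed by a -1 restores the state. This is what `addMinus` does to row `i₁` and column
-- `j₁`.
Alt-insertPair : ∀ {n} {v w : Fin n → Sgn} x y → toℕ x < toℕ y → Alt false v → (∀ z → toℕ z ≤ toℕ y → v z ≡ zer) →
  w x ≡ pos → w y ≡ neg → (∀ z → z ≢ x → z ≢ y → w z ≡ v z) → Alt false w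
Alt-insertPair x y x<y (plus e _) z _ _ _ = contradiction (trans (sym (z zero z≤n)) e) λ ()
Alt-insertPair zero (suc y) x<y (skip e A) z eₓ e_y same =
  plus eₓ (Alt-insert y A (λ x x≤y → z (suc x) (s≤s x≤y)) e_y (λ x x≢y → same (suc x) (λ ()) (x≢y ∘ suc-injective)))
Alt-insertPair (suc x) (suc y) (s≤s x<y) (skip e A) z eₓ e_y same =
  skip (trans (same zero (λ ()) (λ ())) e) (Alt-insertPair x y x<y A (λ u u≤y → z (suc u) (s≤s u≤y)) eₓ e_y
    (λ u u≢x u≢y → same (suc u) (u≢x ∘ suc-injective) (u≢y ∘ suc-injective)))

-- A +1 may slide across zeros. This is what `addMinus` does to row `i₀` and column `j₀`.
Alt-movePlus : ∀ {n b} {v w : Fin n → Sgn} x y → toℕ x < toℕ y → Alt b v → v x ≡ pos → (∀ z → toℕ x < toℕ z → toℕ z ≤ toℕ y → v z ≡ zer) →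
  w x ≡ zer → w y ≡ pos → (∀ z → z ≢ x → z ≢ y → w z ≡ v z) → Alt b w
Alt-movePlus zero (suc y) x<y (skip e _)  e₀ = contradiction (trans (sym e) e₀) λ ()
Alt-movePlus zero (suc y) x<y (minus e _) e₀ = contradiction (trans (sym e) e₀) λ ()
Alt-movePlus zero (suc y) x<y (plus e A) e₀ z eₓ e_y same =
  skip eₓ (Alt-insert y A (λ u u≤y → z (suc u) (s≤s z≤n) (s≤s u≤y)) e_y (λ u u≢y → same (suc u) (λ ()) (u≢y ∘ suc-injective)))
Alt-movePlus {v = v} {w} (suc x) (suc y) (s≤s x<y) A e₀ z eₓ e_y same = go A
  where
  rec : ∀ {b} → Alt b (v ∘ suc) → Alt b (w ∘ suc)
  rec A = Alt-movePlus x y x<y A e₀ (λ u x<u u≤y → z (suc u) (s≤s x<u) (s≤s u≤y)) eₓ e_y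
            (λ u u≢x u≢y → same (suc u) (u≢x ∘ suc-injective) (u≢y ∘ suc-injective))
  head : w zero ≡ v zero
  head = same zero (λ ()) (λ ())
  go : ∀ {b} → Alt b v → Alt b w
  go (skip e A)  = skip (trans head e) (rec A)
  go (plus e A)  = plus (trans head e) (rec A)
  go (minus e A) = minus (trans head e) (rec A)

-- Decompositions A + B + C = J.

-- A cell records which of the summands A, B = P₁ + … + P_{k-1} and C = P_{k+1} + … + P_n are nonzero there;
-- inBC is an entry -1 of A, which lies between a 1 of B and a 1 of C on its vertical line.
data Cell : Set where
  inA inB inC inBC : Cell

sgn : Cell → Sgn
sgn inA = pos
sgn inB = zer
sgn inC = zer
sgn inBC = neg

bv cv mv : Cell → ℕ
bv inA = 0
bv inB = 1
bv inC = 0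
bv inBC = 1
cv inA = 0
cv inB = 0
cv inC = 1
cv inBC = 1
mv inA = 0
mv inB = 0
mv inC = 0
mv inBC = 1

-- The identity A + B + C = J and the 0/1 entries of B and C are built into `Cell`; what remains is
-- that A is an alternating sign matrix and that B and C split into permutation matrices.
record State (n p q t : ℕ) : Set where
  field
    cell  : Fin n → Fin n → Cell
    size  : n ≡ suc (p + q)
    rows  : ∀ i → Alt false (λ j → sgn (cell i j))
    cols  : ∀ j → Alt false (λ i → sgn (cell i j))
    regB  : PermSum p (λ i j → bv (cell i j))
    regC  : PermSum q (λ i j → cv (cell i j))
    count : sum (λ i → sum (λ j → mv (cell i j))) ≡ t
open State

-- Extension by a row and a column.

extCell : ∀ {n} → (Fin n → Fin n → Cell) → Permutation′ n → (Fin n → Bool) → Fin (suc n) → Fin (suc n) → Cell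
extCell cl π s zero    zero    = inA
extCell cl π s zero    (suc j) = if s (π ⟨$⟩ˡ j) then inC else inB
extCell cl π s (suc i) zero    = if s i then inC else inB
extCell cl π s (suc i) (suc j) = if does ((π ⟨$⟩ʳ i) ≟ j) ∧ s i then inB else cl i j

private
  sgn-if : ∀ x → sgn (if x then inC else inB) ≡ zer
  sgn-if true  = refl
  sgn-if false = refl

  mv-if : ∀ x → mv (if x then inC else inB) ≡ 0
  mv-if true  = refl
  mv-if false = refl

  bv-if : ∀ x → bv (if x then inC else inB) ≡ ⟦ not x ⟧
  bv-if true  = refl
  bv-if false = refl

  cv-if : ∀ x → cv (if x then inC else inB) ≡ ⟦ x ⟧
  cv-if true  = refl
  cv-if false = refl

sum-not : ∀ {n} (s : Fin n → Bool) → sum (⟦_⟧ ∘ s) + sum (⟦_⟧ ∘ not ∘ s) ≡ n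
sum-not {zero} s = refl
sum-not {suc n} s with s zero
... | true  = cong suc (sum-not (s ∘ suc))
... | false = trans (+-suc (sum (⟦_⟧ ∘ s ∘ suc)) _) (cong suc (sum-not (s ∘ suc)))

module _ {n p q t} (st : State n p q t) (π : Permutation′ n) (s : Fin n → Bool)
         (sub : ∀ i → s i ≡ true → cell st i (π ⟨$⟩ʳ i) ≡ inC) (total : sum (⟦_⟧ ∘ s) ≡ q) where

  private
    cl = cell st
    new = extCell cl π s

    sgn-inner : ∀ i j → sgn (new (suc i) (suc j)) ≡ sgn (cl i j)
    sgn-inner i j with (π ⟨$⟩ʳ i) ≟ j | s i in eq
    ... | yes refl | true = sym (cong sgn (sub i eq))
    ... | yes _ | false = refl
    ... | no _  | _ = refl

    mv-inner : ∀ i j → mv (new (suc i) (suc j)) ≡ mv (cl i j)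
    mv-inner i j with (π ⟨$⟩ʳ i) ≟ j | s i in eq
    ... | yes refl | true = sym (cong mv (sub i eq))
    ... | yes _ | false = refl
    ... | no _  | _ = refl

    bv-inner : ∀ i j → bv (new (suc i) (suc j)) + ⟦ not (s i) ⟧ * mat π i j ≡ mat π i j + bv (cl i j)
    bv-inner i j with (π ⟨$⟩ʳ i) ≟ j | s i in eq
    ... | yes refl | true = cong suc (sym (cong bv (sub i eq)))
    ... | yes _ | false = +-comm (bv (cl i j)) 1
    ... | no _  | x = trans (cong (bv (cl i j) +_) (*-zeroʳ ⟦ not x ⟧)) (+-identityʳ _)

    cv-inner : ∀ i j → cv (new (suc i) (suc j)) + ⟦ s i ⟧ * mat π i j ≡ cv (cl i j)
    cv-inner i j with (π ⟨$⟩ʳ i) ≟ j | s i in eq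
    ... | yes refl | true = sym (cong cv (sub i eq))
    ... | yes _ | false = +-identityʳ _
    ... | no _  | x = trans (cong (cv (cl i j) +_) (*-zeroʳ ⟦ x ⟧)) (+-identityʳ _)

  -- B first gains all of `π` as a new summand and then pushes the p + 1 cells of `π` outside `s` to
  -- the border; C pushes the q cells in `s`. Only cells with A-entry 0 are recoloured, so the old
  -- entries of A stay.
  ext : State (suc n) (suc p) q t
  ext .cell = new
  ext .size = cong suc (size st)
  ext .rows zero    = plus refl (Alt-zero λ j → sgn-if (s (π ⟨$⟩ˡ j)))
  ext .rows (suc i) = skip (sgn-if (s i)) (Alt-cong (sgn-inner i) (rows st i))
  ext .cols zero    = plus refl (Alt-zero λ i → sgn-if (s i))
  ext .cols (suc j) = skip (sgn-if (s (π ⟨$⟩ˡ j))) (Alt-cong (λ i → sgn-inner i j) (cols st j))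
  ext .regB = prolong π (not ∘ s) (cons π (regB st) (λ _ _ → refl))
    (+-cancelˡ-≡ q _ _ (trans (cong (_+ sum (⟦_⟧ ∘ not ∘ s)) (sym total)) (trans (sum-not s) (trans (size st) (+-comm (suc p) q)))))
    (λ i _ → ≤-trans (≤-reflexive (sym (δ-refl {x = π ⟨$⟩ʳ i} refl))) (m≤m+n _ _))
    refl (λ j → bv-if (s (π ⟨$⟩ˡ j))) (λ i → bv-if (s i)) bv-inner
  ext .regC = prolong π s (regC st) total (λ i si → ≤-reflexive (sym (cong cv (sub i si))))
    refl (λ j → cv-if (s (π ⟨$⟩ˡ j))) (λ i → cv-if (s i)) cv-inner
  ext .count = trans (cong₂ _+_ (sum-zero _ λ j → mv-if (s (π ⟨$⟩ˡ j)))
    (sum-cong-≗ λ i → cong₂ _+_ (mv-if (s i)) (sum-cong-≗ (mv-inner i)))) (count st)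

-- Switches that create entries -1.

-- The Booleans tell whether the row is `i₀`, whether it is `i₁`, whether the column is `j₀`, and
-- whether it is `j₁`.
pick : Bool → Bool → Bool → Bool → Cell → Cell
pick true  _     true  _     _ = inC
pick true  _     false true  _ = inA
pick true  _     false false o = o
pick false true  true  _     _ = inA
pick false true  false true  _ = inBC
pick false true  false false o = o
pick false false _     _     o = o

module _ {n p q t} (st : State n p q t) (i₀ i₁ j₀ j₁ : Fin n) (i₀<i₁ : toℕ i₀ < toℕ i₁) (j₀<j₁ : toℕ j₀ < toℕ j₁) where

  private
    cl = cell st

    i₀≢i₁ : i₀ ≢ i₁
    i₀≢i₁ e = <⇒≢ i₀<i₁ (cong toℕ e)

    j₀≢j₁ : j₀ ≢ j₁
    j₀≢j₁ e = <⇒≢ j₀<j₁ (cong toℕ e)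

  stepCell : Fin n → Fin n → Cell
  stepCell x y = pick (does (i₀ ≟ x)) (does (i₁ ≟ x)) (does (j₀ ≟ y)) (does (j₁ ≟ y)) (cl x y)

  step₀₀ : stepCell i₀ j₀ ≡ inC
  step₀₀ rewrite dec-true (i₀ ≟ i₀) refl | dec-true (j₀ ≟ j₀) refl = refl

  step₀₁ : stepCell i₀ j₁ ≡ inA
  step₀₁ rewrite dec-true (i₀ ≟ i₀) refl | dec-false (j₀ ≟ j₁) j₀≢j₁ | dec-true (j₁ ≟ j₁) refl = refl

  step₁₀ : stepCell i₁ j₀ ≡ inA
  step₁₀ rewrite dec-false (i₀ ≟ i₁) i₀≢i₁ | dec-true (i₁ ≟ i₁) refl | dec-true (j₀ ≟ j₀) refl = refl

  step₁₁ : stepCell i₁ j₁ ≡ inBC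
  step₁₁ rewrite dec-false (i₀ ≟ i₁) i₀≢i₁ | dec-true (i₁ ≟ i₁) refl | dec-false (j₀ ≟ j₁) j₀≢j₁ | dec-true (j₁ ≟ j₁) refl = refl

  step-offRow : ∀ {x} y → x ≢ i₀ → x ≢ i₁ → stepCell x y ≡ cl x y
  step-offRow {x} y e₀ e₁ rewrite dec-false (i₀ ≟ x) (e₀ ∘ sym) | dec-false (i₁ ≟ x) (e₁ ∘ sym) = refl

  step-offCol : ∀ x {y} → y ≢ j₀ → y ≢ j₁ → stepCell x y ≡ cl x y
  step-offCol x {y} e₀ e₁ rewrite dec-false (j₀ ≟ y) (e₀ ∘ sym) | dec-false (j₁ ≟ y) (e₁ ∘ sym) with does (i₀ ≟ x) | does (i₁ ≟ x)
  ... | true  | _     = refl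
  ... | false | true  = refl
  ... | false | false = refl

  module _ (v₀₀ : cl i₀ j₀ ≡ inA) (v₀₁ : cl i₀ j₁ ≡ inC) (v₁₀ : cl i₁ j₀ ≡ inC) (v₁₁ : cl i₁ j₁ ≡ inB)
           (zrow₀ : ∀ y → toℕ j₀ < toℕ y → toℕ y ≤ toℕ j₁ → sgn (cl i₀ y) ≡ zer)
           (zrow₁ : ∀ y → toℕ y ≤ toℕ j₁ → sgn (cl i₁ y) ≡ zer)
           (zcol₀ : ∀ x → toℕ i₀ < toℕ x → toℕ x ≤ toℕ i₁ → sgn (cl x j₀) ≡ zer)
           (zcol₁ : ∀ x → toℕ x ≤ toℕ i₁ → sgn (cl x j₁) ≡ zer) where

    private
      values : ∀ x y → bv (stepCell x y) ≡ bv (cl x y)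
                     × cv (stepCell x y) + (E i₀ j₁ x y + E i₁ j₀ x y) ≡ cv (cl x y) + (E i₀ j₀ x y + E i₁ j₁ x y)
                     × mv (stepCell x y) ≡ mv (cl x y) + E i₁ j₁ x y
      values x y with i₀ ≟ x | i₁ ≟ x | j₀ ≟ y | j₁ ≟ y
      ... | yes refl | yes e    | _        | _        = contradiction (sym e) i₀≢i₁
      ... | _        | _        | yes refl | yes e    = contradiction (sym e) j₀≢j₁
      ... | yes refl | no _     | yes refl | no _     rewrite v₀₀ = refl , refl , refl
      ... | yes refl | no _     | no _     | yes refl rewrite v₀₁ = refl , refl , refl
      ... | yes refl | no _     | no _     | no _     = refl , refl , sym (+-identityʳ _)
      ... | no _     | yes refl | yes refl | no _     rewrite v₁₀ = refl , refl , refl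
      ... | no _     | yes refl | no _     | yes refl rewrite v₁₁ = refl , refl , refl
      ... | no _     | yes refl | no _     | no _     = refl , refl , sym (+-identityʳ _)
      ... | no _     | no _     | _        | _        = refl , refl , sym (+-identityʳ _)

      newC : PermSum q (λ x y → cv (stepCell x y))
      newC with switch {i = i₀} {i₁} {j₀} {j₁} i₀≢i₁ (regC st) (≤-reflexive (sym (cong cv v₀₁))) (≤-reflexive (sym (cong cv v₁₀)))
      ... | M′ , R′ , e = PermSum-cong (λ x y → +-cancelʳ-≡ (E i₀ j₁ x y + E i₁ j₀ x y) _ _ (trans (proj₁ (proj₂ (values x y))) (sym (e x y)))) R′

      newRows : ∀ x → Alt false (λ y → sgn (stepCell x y))
      newRows x with x ≟ i₀ | x ≟ i₁
      ... | yes refl | _ = Alt-movePlus j₀ j₁ j₀<j₁ (rows st x) (cong sgn v₀₀) zrow₀ (cong sgn step₀₀) (cong sgn step₀₁) (λ y e e′ → cong sgn (step-offCol x e e′))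
      ... | no _ | yes refl = Alt-insertPair j₀ j₁ j₀<j₁ (rows st x) zrow₁ (cong sgn step₁₀) (cong sgn step₁₁) (λ y e e′ → cong sgn (step-offCol x e e′))
      ... | no e | no e′ = Alt-cong (λ y → cong sgn (step-offRow y e e′)) (rows st x)

      newCols : ∀ y → Alt false (λ x → sgn (stepCell x y))
      newCols y with y ≟ j₀ | y ≟ j₁
      ... | yes refl | _ = Alt-movePlus i₀ i₁ i₀<i₁ (cols st y) (cong sgn v₀₀) zcol₀ (cong sgn step₀₀) (cong sgn step₁₀) (λ x e e′ → cong sgn (step-offRow y e e′))
      ... | no _ | yes refl = Alt-insertPair i₀ i₁ i₀<i₁ (cols st y) zcol₁ (cong sgn step₀₁) (cong sgn step₁₁) (λ x e e′ → cong sgn (step-offRow y e e′))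
      ... | no e | no e′ = Alt-cong (λ x → cong sgn (step-offCol x e e′)) (cols st y)

    -- C undergoes a switch and A the opposite one, while B is unchanged; so A + B + C = J persists,
    -- and the entry of A at `(i₁ , j₁)` drops from 0 to -1.
    addMinus : State n p q (suc t)
    addMinus .cell = stepCell
    addMinus .size = size st
    addMinus .rows = newRows
    addMinus .cols = newCols
    addMinus .regB = PermSum-cong (λ x y → proj₁ (values x y)) (regB st)
    addMinus .regC = newC
    addMinus .count = begin
      sum (λ x → sum (λ y → mv (stepCell x y)))                  ≡⟨ sum-cong-≗ (λ x → sum-cong-≗ (λ y → proj₂ (proj₂ (values x y)))) ⟩
      sum (λ x → sum (λ y → mv (cl x y) + E i₁ j₁ x y))          ≡⟨ sum-cong-≗ (λ x → ∑-distrib-+ (λ y → mv (cl x y)) (E i₁ j₁ x)) ⟩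
      sum (λ x → sum (λ y → mv (cl x y)) + sum (E i₁ j₁ x))      ≡⟨ ∑-distrib-+ (λ x → sum (λ y → mv (cl x y))) (λ x → sum (E i₁ j₁ x)) ⟩
      sum (λ x → sum (λ y → mv (cl x y))) + sum (λ x → sum (E i₁ j₁ x)) ≡⟨ cong₂ _+_ (count st) (∑∑E≡1 i₁ j₁) ⟩
      t + 1                                                      ≡⟨ +-comm t 1 ⟩
      suc t                                                      ∎
      where open ≡-Reasoning

-- The stages of the passage from a corner entry 1 back to a full triangle: the 1 in row 0 has moved to column e.
record Chain (n p q t e : ℕ) : Set where
  field
    state   : State (suc n) p q t
    topA    : ∀ j → toℕ j ≡ e → cell state zero j ≡ inA
    topC    : ∀ j → toℕ j ≤ q → toℕ j ≢ e → cell state zero j ≡ inC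
    below   : ∀ i j → suc (toℕ i) + toℕ j < q → cell state (suc i) j ≡ inC
    diag    : ∀ i j → suc (toℕ i) + toℕ j ≡ q → e ≤ toℕ j → cell state (suc i) j ≡ inC
    subdiag : ∀ i j → suc (toℕ i) + toℕ j ≡ suc q → e < toℕ j → cell state (suc i) j ≡ inB
open Chain

chain-step : ∀ {n p t} d e → Chain n p (suc e + d) t e → Chain n p (suc e + d) (suc t) (suc e)
chain-step {n} {p} {t} d e ch = record
  { state = addMinus st zero i₁ j₀ j₁ i₀<i₁ j₀<j₁ (topA ch j₀ #j₀) v₀₁ v₁₀ v₁₁ zrow₀ zrow₁ zcol₀ zcol₁
  ; topA = λ j #j → trans (cong (stepCell st zero i₁ j₀ j₁ i₀<i₁ j₀<j₁ zero) (toℕ-injective (trans #j (sym #j₁)))) (step₀₁ st zero i₁ j₀ j₁ i₀<i₁ j₀<j₁)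
  ; topC = newTopC
  ; below = λ i j lt → trans (same i j λ #i → let j<e = +-cancelˡ-< (suc d) _ _ (subst₂ _<_ (cong (λ x → suc x + toℕ j) #i) q≡ lt)
                                              in <⇒≢ j<e , <⇒≢ (m<n⇒m<1+n j<e))
                             (below ch i j lt)
  ; diag = λ i j eq e<j → trans (same i j λ #i → contradiction (sym (on-diag i j #i eq)) (<⇒≢ e<j)) (diag ch i j eq (<⇒≤ e<j))
  ; subdiag = λ i j eq e<j → trans (same i j λ #i → contradiction (sym (on-subdiag i j #i eq)) (<⇒≢ e<j)) (subdiag ch i j eq (<⇒≤ e<j))
  }
  where
  st = state ch
  q = suc e + d

  q≡ : q ≡ suc d + e
  q≡ = cong suc (+-comm e d)

  q≤n : q ≤ n
  q≤n = ≤-trans (m≤n+m q p) (≤-reflexive (sym (cong pred (size st))))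

  d<n : d < n
  d<n = ≤-trans (s≤s (m≤n+m d e)) q≤n

  se<sn : suc e < suc n
  se<sn = s≤s (≤-trans (m≤m+n (suc e) d) q≤n)

  -- Row d + 1 is the one that meets column e on the antidiagonal i + j = q, in a C cell, and column
  -- e + 1 on i + j = q + 1, in a B cell.
  i₁ j₀ j₁ : Fin (suc n)
  i₁ = suc (fromℕ< d<n)
  j₀ = fromℕ< (<-trans (n<1+n e) se<sn)
  j₁ = fromℕ< se<sn

  #j₀ : toℕ j₀ ≡ e
  #j₀ = toℕ-fromℕ< (<-trans (n<1+n e) se<sn)

  #j₁ : toℕ j₁ ≡ suc e
  #j₁ = toℕ-fromℕ< se<sn

  #i₁ : toℕ (fromℕ< d<n) ≡ d
  #i₁ = toℕ-fromℕ< d<n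

  i₀<i₁ : 0 < toℕ i₁
  i₀<i₁ = s≤s z≤n

  j₀<j₁ : toℕ j₀ < toℕ j₁
  j₀<j₁ = ≤-reflexive (trans (cong suc #j₀) (sym #j₁))

  on-diag : ∀ i j → toℕ i ≡ d → suc (toℕ i) + toℕ j ≡ q → toℕ j ≡ e
  on-diag i j refl eq = +-cancelˡ-≡ (suc d) _ _ (trans eq q≡)

  on-subdiag : ∀ i j → toℕ i ≡ d → suc (toℕ i) + toℕ j ≡ suc q → toℕ j ≡ suc e
  on-subdiag i j refl eq = +-cancelˡ-≡ (suc d) _ _ (trans eq (trans (cong suc q≡) (sym (+-suc (suc d) e))))

  same : ∀ i j → (toℕ i ≡ d → toℕ j ≢ e × toℕ j ≢ suc e) → stepCell st zero i₁ j₀ j₁ i₀<i₁ j₀<j₁ (suc i) j ≡ cell st (suc i) j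
  same i j off with toℕ i ≟ℕ d
  ... | yes #i = step-offCol st zero i₁ j₀ j₁ i₀<i₁ j₀<j₁ (suc i) (λ eq → proj₁ (off #i) (trans (cong toℕ eq) #j₀)) (λ eq → proj₂ (off #i) (trans (cong toℕ eq) #j₁))
  ... | no i≢d = step-offRow st zero i₁ j₀ j₁ i₀<i₁ j₀<j₁ j (λ ()) (λ eq → i≢d (trans (cong toℕ (suc-injective eq)) #i₁))

  newTopC : ∀ j → toℕ j ≤ q → toℕ j ≢ suc e → stepCell st zero i₁ j₀ j₁ i₀<i₁ j₀<j₁ zero j ≡ inC
  newTopC j j≤q j≢se with toℕ j ≟ℕ e
  ... | yes #j = trans (cong (stepCell st zero i₁ j₀ j₁ i₀<i₁ j₀<j₁ zero) (toℕ-injective (trans #j (sym #j₀)))) (step₀₀ st zero i₁ j₀ j₁ i₀<i₁ j₀<j₁)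
  ... | no j≢e = trans (step-offCol st zero i₁ j₀ j₁ i₀<i₁ j₀<j₁ zero (λ eq → j≢e (trans (cong toℕ eq) #j₀)) (λ eq → j≢se (trans (cong toℕ eq) #j₁)))
                       (topC ch j j≤q j≢e)

  v₀₁ : cell st zero j₁ ≡ inC
  v₀₁ = topC ch j₁ (≤-trans (≤-reflexive #j₁) (m≤m+n (suc e) d)) (λ eq → 1+n≢n (trans (sym #j₁) eq))

  v₁₀ : cell st i₁ j₀ ≡ inC
  v₁₀ = diag ch _ j₀ (trans (cong₂ (λ x y → suc x + y) #i₁ #j₀) (sym q≡)) (≤-reflexive (sym #j₀))

  v₁₁ : cell st i₁ j₁ ≡ inB
  v₁₁ = subdiag ch _ j₁ (trans (cong₂ (λ x y → suc x + y) #i₁ #j₁) (trans (+-suc (suc d) e) (cong suc (sym q≡)))) (≤-reflexive (sym #j₁))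

  -- Below row 0, the cells with i + j at most q + 1 that the earlier switches have not reached are
  -- B or C cells, so A vanishes there.
  zeroAt : ∀ i j → suc (toℕ i) + toℕ j ≤ suc q → (suc (toℕ i) + toℕ j ≡ q → e ≤ toℕ j) → (suc (toℕ i) + toℕ j ≡ suc q → e < toℕ j) → sgn (cell st (suc i) j) ≡ zer
  zeroAt i j ≤sq at≡ at≡s with m≤n⇒m<n∨m≡n ≤sq
  ... | inj₂ eq = cong sgn (subdiag ch i j eq (at≡s eq))
  ... | inj₁ (s≤s ≤q) with m≤n⇒m<n∨m≡n ≤q
  ...   | inj₂ eq = cong sgn (diag ch i j eq (at≡ eq))
  ...   | inj₁ lt = cong sgn (below ch i j lt)

  zrow₀ : ∀ y → toℕ j₀ < toℕ y → toℕ y ≤ toℕ j₁ → sgn (cell st zero y) ≡ zer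
  zrow₀ y j₀<y y≤j₁ = cong sgn (trans (cong (cell st zero) (toℕ-injective (≤-antisym y≤j₁ (subst (_≤ toℕ y) (trans (cong suc #j₀) (sym #j₁)) j₀<y)))) v₀₁)

  zrow₁ : ∀ y → toℕ y ≤ toℕ j₁ → sgn (cell st i₁ y) ≡ zer
  zrow₁ y y≤j₁ = zeroAt _ y
    (≤-trans (+-mono-≤ (≤-reflexive (cong suc #i₁)) (≤-trans y≤j₁ (≤-reflexive #j₁))) (≤-reflexive (trans (+-suc (suc d) e) (cong suc (sym q≡)))))
    (λ eq → ≤-reflexive (sym (on-diag _ y #i₁ eq)))
    (λ eq → ≤-reflexive (sym (on-subdiag _ y #i₁ eq)))

  zcol₀ : ∀ x → 0 < toℕ x → toℕ x ≤ toℕ i₁ → sgn (cell st x j₀) ≡ zer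
  zcol₀ (suc x) _ (s≤s x≤d) = zeroAt x j₀ (m≤n⇒m≤1+n ≤q) (λ _ → ≤-reflexive (sym #j₀)) (λ eq → contradiction (≤-trans (≤-reflexive (sym eq)) ≤q) 1+n≰n)
    where
    ≤q : suc (toℕ x) + toℕ j₀ ≤ q
    ≤q = ≤-trans (+-mono-≤ (s≤s (≤-trans x≤d (≤-reflexive #i₁))) (≤-reflexive #j₀)) (≤-reflexive (sym q≡))

  zcol₁ : ∀ x → toℕ x ≤ toℕ i₁ → sgn (cell st x j₁) ≡ zer
  zcol₁ zero _ = cong sgn v₀₁
  zcol₁ (suc x) (s≤s x≤d) = zeroAt x j₁
    (≤-trans (+-mono-≤ (s≤s (≤-trans x≤d (≤-reflexive #i₁))) (≤-reflexive #j₁)) (≤-reflexive (trans (+-suc (suc d) e) (cong suc (sym q≡)))))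
    (λ _ → ≤-trans (n≤1+n e) (≤-reflexive (sym #j₁))) (λ _ → ≤-reflexive (sym #j₁))

-- Decompositions with pq entries -1.

record MaxState (n p q t : ℕ) : Set where
  field
    state    : State n p q t
    triangle : ∀ i j → toℕ i + toℕ j < q → cell state i j ≡ inC
open MaxState

private
  -- Reverses 0, ..., q - 1 and fixes the rest, so that its graph over x < q is the antidiagonal i +
  -- j = q - 1.
  mirror : ℕ → ℕ → ℕ
  mirror q x = if does (x <? q) then q ∸ suc x else x

  mirror-< : ∀ {q x} → x < q → mirror q x ≡ q ∸ suc x
  mirror-< {q} {x} x<q rewrite dec-true (x <? q) x<q = refl

  mirror-≥ : ∀ {q x} → ¬ x < q → mirror q x ≡ x
  mirror-≥ {q} {x} x≮q rewrite dec-false (x <? q) x≮q = refl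

  pred-∸< : ∀ {q x} → x < q → q ∸ suc x < q
  pred-∸< {suc q} {x} _ = s≤s (m∸n≤m q x)

  mirror-bound : ∀ {q n x} → q ≤ n → x < n → mirror q x < n
  mirror-bound {q} {n} {x} q≤n x<n with x <? q
  ... | yes x<q = ≤-trans (subst (_< q) (sym (mirror-< x<q)) (pred-∸< x<q)) q≤n
  ... | no x≮q = subst (_< n) (sym (mirror-≥ x≮q)) x<n

  mirror-involutive : ∀ q x → mirror q (mirror q x) ≡ x
  mirror-involutive q x with x <? q
  ... | no x≮q = trans (cong (mirror q) (mirror-≥ x≮q)) (mirror-≥ x≮q)
  ... | yes x<q@(s≤s x≤q′) = trans (cong (mirror q) (mirror-< x<q)) (trans (mirror-< (pred-∸< x<q)) (m∸[m∸n]≡n x≤q′))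

mirrorₚ : ∀ {n} q → q ≤ n → Permutation′ n
mirrorₚ {n} q q≤n = permutation f f f-involutive f-involutive
  where
  f : Fin n → Fin n
  f i = fromℕ< (mirror-bound q≤n (toℕ<n i))
  f-involutive : ∀ i → f (f i) ≡ i
  f-involutive i = toℕ-injective (trans (toℕ-fromℕ< _) (trans (cong (mirror q) (toℕ-fromℕ< _)) (mirror-involutive q (toℕ i))))

toℕ-mirrorₚ : ∀ {n} q (q≤n : q ≤ n) i → toℕ (mirrorₚ q q≤n ⟨$⟩ʳ i) ≡ mirror q (toℕ i)
toℕ-mirrorₚ q q≤n i = toℕ-fromℕ< _

sum-initial : ∀ {n} q → q ≤ n → sum (λ (i : Fin n) → ⟦ does (toℕ i <? q) ⟧) ≡ q
sum-initial {n} zero    _         = sum-zero _ λ (i : Fin n) → refl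
sum-initial (suc q) (s≤s q≤n) = cong suc (sum-initial q q≤n)

-- The extension selects the antidiagonal i + j = q - 1 of the triangle. The border shifts it to i +
-- j = q + 1, now as B cells, and the rest of the triangle together with the new C cells fills i + j
-- at most q, apart from the corner.
chain-start : ∀ {n p q t} → MaxState n p q t → Chain n (suc p) q t 0
chain-start {n} {p} {q} {t} ms = record
  { state = ext st π s sub (sum-initial q q≤n)
  ; topA = λ { zero _ → refl }
  ; topC = λ { zero _ j≢0 → contradiction refl j≢0
             -- `π` is its own inverse by construction, so `toℕ-mirrorₚ` applies to `π ⟨$⟩ˡ j` as
             -- well.
             ; (suc j) j<q _ → cong (if_then inC else inB) (initial (π ⟨$⟩ˡ j) (subst (_< q) (sym (trans (toℕ-mirrorₚ q q≤n j) (mirror-< j<q))) (pred-∸< j<q))) }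
  ; below = λ { i zero lt → cong (if_then inC else inB) (initial i (<-trans (n<1+n _) (subst (_< q) (+-identityʳ _) lt)))
              ; i (suc j) lt → let lt′ = subst (_< q) (cong suc (+-suc (toℕ i) (toℕ j))) lt in
                  inner i j (<-trans (n<1+n _) (<-trans (n<1+n _) lt′)) (<⇒≢ (<-trans (n<1+n _) lt′)) }
  ; diag = λ { i zero eq _ → cong (if_then inC else inB) (initial i (≤-reflexive (trans (sym (+-identityʳ _)) eq)))
             ; i (suc j) eq _ → let eq′ = trans (sym (cong suc (+-suc (toℕ i) (toℕ j)))) eq in
                  inner i j (<⇒≤ (≤-reflexive eq′)) (<⇒≢ (≤-reflexive eq′)) }
  ; subdiag = λ { i (suc j) eq _ → antidiag i j (cong pred (trans (sym (cong suc (+-suc (toℕ i) (toℕ j)))) eq)) }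
  }
  where
  st = state ms
  q≤n : q ≤ n
  q≤n = ≤-trans (m≤n+m q (suc p)) (≤-reflexive (sym (size st)))
  π = mirrorₚ q q≤n
  s : Fin n → Bool
  s i = does (toℕ i <? q)

  initial : ∀ i → toℕ i < q → s i ≡ true
  initial i i<q = dec-true (toℕ i <? q) i<q

  π-sum : ∀ i → toℕ i < q → suc (toℕ i + toℕ (π ⟨$⟩ʳ i)) ≡ q
  π-sum i i<q = trans (cong (λ x → suc (toℕ i + x)) (trans (toℕ-mirrorₚ q q≤n i) (mirror-< i<q))) (m+[n∸m]≡n i<q)

  sub : ∀ i → s i ≡ true → cell st i (π ⟨$⟩ʳ i) ≡ inC
  sub i si with toℕ i <? q
  ... | yes i<q = triangle ms i _ (≤-reflexive (π-sum i i<q))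
  ... | no i≮q = contradiction (trans (sym (dec-false (toℕ i <? q) i≮q)) si) λ ()

  inner : ∀ i j → toℕ i + toℕ j < q → suc (toℕ i + toℕ j) ≢ q → extCell (cell st) π s (suc i) (suc j) ≡ inC
  inner i j lt ne with (π ⟨$⟩ʳ i) ≟ j | toℕ i <? q
  ... | yes refl | yes i<q = contradiction (π-sum i i<q) ne
  ... | yes _    | no i≮q  = trans (cong (if_then inB else cell st i j) (dec-false (toℕ i <? q) i≮q)) (triangle ms i j lt)
  ... | no _     | _       = triangle ms i j lt

  antidiag : ∀ i j → suc (toℕ i + toℕ j) ≡ q → extCell (cell st) π s (suc i) (suc j) ≡ inB
  antidiag i j eq = cong (if_then inB else cell st i j) (cong₂ _∧_ (dec-true (π ⟨$⟩ʳ i ≟ j) πi≡j) (initial i i<q))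
    where
    i<q : toℕ i < q
    i<q = ≤-trans (s≤s (m≤m+n (toℕ i) (toℕ j))) (≤-reflexive eq)
    πi≡j : π ⟨$⟩ʳ i ≡ j
    πi≡j = toℕ-injective (+-cancelˡ-≡ (suc (toℕ i)) _ _ (trans (π-sum i i<q) (sym eq)))

chain : ∀ {n p q t} → MaxState n p q t → ∀ e → e ≤ q → Chain n (suc p) q (e + t) e
chain ms zero    _   = chain-start ms
chain ms (suc e) e<q with m≤n⇒∃[o]m+o≡n e<q
... | d , refl = chain-step d e (chain ms e (<⇒≤ e<q))

chain-end : ∀ {n p q t} → Chain n p q t q → MaxState (suc n) p q t
chain-end ch .state = state ch
chain-end ch .triangle zero    j lt = topC ch j (<⇒≤ lt) (<⇒≢ lt)
chain-end ch .triangle (suc i) j lt = below ch i j lt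

sum-ones : ∀ n → sum {n} (λ _ → 1) ≡ n
sum-ones zero    = refl
sum-ones (suc n) = cong suc (sum-ones n)

mutual
  -- The all-ones matrix J is the identity plus J - I.
  PermSum-ones : ∀ n → PermSum {n} n (λ _ _ → 1)
  PermSum-ones zero    = [] λ ()
  PermSum-ones (suc n) = cons idₚ (PermSum-offDiagonal n) λ i j → sym (one (does (i ≟ j)))
    where
    one : ∀ x → ⟦ x ⟧ + ⟦ not x ⟧ ≡ 1
    one true  = refl
    one false = refl

  -- Pushing the whole diagonal of J of order n to the border leaves J - I of order n + 1, still
  -- with n summands.
  PermSum-offDiagonal : ∀ n → PermSum {suc n} n (λ i j → ⟦ not (does (i ≟ j)) ⟧)
  PermSum-offDiagonal n = prolong idₚ (λ _ → true) (PermSum-ones n) (sum-ones n) (λ _ _ → ≤-refl)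
    refl (λ _ → refl) (λ _ → refl) (λ i j → one (does (i ≟ j)))
    where
    one : ∀ x → ⟦ not x ⟧ + (⟦ x ⟧ + 0) ≡ 1
    one true  = refl
    one false = refl

PermSum-reverse : ∀ {n r} {M : Fin n → Fin n → ℕ} → PermSum r M → PermSum r (λ i j → M (opposite i) j)
PermSum-reverse ([] z) = [] λ i → z (opposite i)
PermSum-reverse (cons π R e) = cons (reverse ∘ₚ π) (PermSum-reverse R) λ i → e (opposite i)

-- A is the reversal permutation matrix, with its 1s on i + j = q just beyond the triangle, and C =
-- J - A.
max-base : ∀ q → MaxState (suc q) 0 q 0
max-base q = record
  { state = record
    { cell = λ i j → cl (does (opposite i ≟ j))
    ; size = refl
    ; rows = λ i → Alt-single (opposite i) (cong (sgn ∘ cl) (dec-true (opposite i ≟ opposite i) refl))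
                     (λ j j≢ → cong (sgn ∘ cl) (dec-false (opposite i ≟ j) (j≢ ∘ sym)))
    ; cols = λ j → Alt-single (opposite j) (cong (sgn ∘ cl) (dec-true (opposite (opposite j) ≟ j) (opposite-involutive j)))
                     (λ i i≢ → cong (sgn ∘ cl) (dec-false (opposite i ≟ j) (λ eq → i≢ (trans (sym (opposite-involutive i)) (cong opposite eq)))))
    ; regB = [] λ i j → noB (does (opposite i ≟ j))
    ; regC = PermSum-cong (λ i j → cv-cl (does (opposite i ≟ j))) (PermSum-reverse (PermSum-offDiagonal q))
    ; count = sum-zero {suc q} _ λ i → sum-zero {suc q} _ λ j → noM (does (opposite i ≟ j))
    }
  ; triangle = λ i j lt → cong cl (dec-false (opposite i ≟ j) λ eq →
      <⇒≢ lt (trans (cong (toℕ i +_) (trans (cong toℕ (sym eq)) (opposite-prop i))) (m+[n∸m]≡n (s≤s⁻¹ (toℕ<n i)))))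
  }
  where
  cl : Bool → Cell
  cl x = if x then inA else inC
  noB : ∀ x → bv (cl x) ≡ 0
  noB true  = refl
  noB false = refl
  noM : ∀ x → mv (cl x) ≡ 0
  noM true  = refl
  noM false = refl
  cv-cl : ∀ x → cv (cl x) ≡ ⟦ not x ⟧
  cv-cl true  = refl
  cv-cl false = refl

-- Each increase of p runs through a full chain, whose q switches contribute q entries -1.
max : ∀ p q → MaxState (suc (p + q)) p q (p * q)
max zero    q = max-base q
max (suc p) q = chain-end (chain (max p q) q ≤-refl)

-- Every number of entries -1 up to pq.

∑∑-cons : ∀ {n} {M M₀ : Fin n → Fin n → ℕ} (w : Fin n → Fin n → ℕ) (π : Permutation′ n) → (∀ i j → M i j ≡ mat π i j + M₀ i j) →
  sum (λ i → sum (λ j → M i j * w i j)) ≡ sum (λ i → w i (π ⟨$⟩ʳ i)) + sum (λ i → sum (λ j → M₀ i j * w i j))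
∑∑-cons {M = M} {M₀} w π e = trans (sum-cong-≗ row) (∑-distrib-+ (λ i → w i (π ⟨$⟩ʳ i)) (λ i → sum (λ j → M₀ i j * w i j)))
  where
  row : ∀ i → sum (λ j → M i j * w i j) ≡ w i (π ⟨$⟩ʳ i) + sum (λ j → M₀ i j * w i j)
  row i = begin
    sum (λ j → M i j * w i j)                                          ≡⟨ sum-cong-≗ (λ j → trans (cong (_* w i j) (e i j)) (*-distribʳ-+ (w i j) (mat π i j) (M₀ i j))) ⟩
    sum (λ j → mat π i j * w i j + M₀ i j * w i j)                     ≡⟨ ∑-distrib-+ (λ j → mat π i j * w i j) (λ j → M₀ i j * w i j) ⟩
    sum (λ j → mat π i j * w i j) + sum (λ j → M₀ i j * w i j)         ≡⟨ cong (_+ _) (sum-single _ (π ⟨$⟩ʳ i) (λ j j≢ → cong (_* w i j) (δ-≢ (j≢ ∘ sym)))) ⟩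
    mat π i (π ⟨$⟩ʳ i) * w i (π ⟨$⟩ʳ i) + sum (λ j → M₀ i j * w i j)   ≡⟨ cong (λ d → d * w i (π ⟨$⟩ʳ i) + _) (δ-refl {x = π ⟨$⟩ʳ i} refl) ⟩
    1 * w i (π ⟨$⟩ʳ i) + sum (λ j → M₀ i j * w i j)                    ≡⟨ cong (_+ sum (λ j → M₀ i j * w i j)) (*-identityˡ (w i (π ⟨$⟩ʳ i))) ⟩
    w i (π ⟨$⟩ʳ i) + sum (λ j → M₀ i j * w i j)                        ∎
    where open ≡-Reasoning

-- If the first summand weighs more than p, the other r weigh less than p * r together, and the
-- search continues among them. The strict inequality excludes r = 0.
lightPermutation : ∀ {n} r p {M : Fin n → Fin n → ℕ} (w : Fin n → Fin n → ℕ) → PermSum (suc r) M →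
  sum (λ i → sum (λ j → M i j * w i j)) ≤ p * suc r → ∃ λ π → sum (λ i → w i (π ⟨$⟩ʳ i)) ≤ p × (∀ i → 1 ≤ M i (π ⟨$⟩ʳ i))
lightPermutation r p {M} w (cons {M = M₀} π R e) bound with sum (λ i → w i (π ⟨$⟩ʳ i)) ≤? p
... | yes light = π , light , λ i → subst (1 ≤_) (sym (e i _)) (≤-trans (≤-reflexive (sym (δ-refl {x = π ⟨$⟩ʳ i} refl))) (m≤m+n _ _))
... | no heavy = rest r R (+-cancelˡ-< p _ _ (≤-trans (+-monoˡ-≤ _ (≰⇒> heavy)) (≤-trans (≤-reflexive (sym (∑∑-cons w π e))) (≤-trans bound (≤-reflexive (*-suc p r))))))
  where
  rest : ∀ r → PermSum r M₀ → sum (λ i → sum (λ j → M₀ i j * w i j)) < p * r → ∃ λ π → sum (λ i → w i (π ⟨$⟩ʳ i)) ≤ p × (∀ i → 1 ≤ M i (π ⟨$⟩ʳ i))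
  rest zero    _  lt = contradiction (≤-trans lt (≤-reflexive (*-zeroʳ p))) λ ()
  rest (suc r) R₀ lt with lightPermutation r p w R₀ (<⇒≤ lt)
  ... | π₁ , light , inM₀ = π₁ , light , λ i → subst (1 ≤_) (sym (e i _)) (≤-trans (inM₀ i) (m≤n+m _ _))

subset : ∀ {n} (g : Fin n → Bool) q → q ≤ sum (⟦_⟧ ∘ g) → ∃ λ (s : Fin n → Bool) → sum (⟦_⟧ ∘ s) ≡ q × (∀ i → s i ≡ true → g i ≡ true)
subset {n} g zero _ = (λ _ → false) , sum-zero {n} _ (λ _ → refl) , λ _ ()
subset {suc n} g (suc q) le with g zero in eq
... | true with subset (g ∘ suc) q (s≤s⁻¹ le)
...   | s , total , s⊆g = (λ { zero → true ; (suc i) → s i }) , cong suc total , λ { zero _ → eq ; (suc i) → s⊆g i }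
subset {suc n} g (suc q) le | false with subset (g ∘ suc) (suc q) le
...   | s , total , s⊆g = (λ { zero → false ; (suc i) → s i }) , total , λ { zero () ; (suc i) → s⊆g i }

isC : Cell → Bool
isC inC = true
isC _ = false

-- Averaging over the q permutation matrices that make up C, one of them meets at most p entries -1 of A.
extend : ∀ {n p q t} → State n p q t → t ≤ p * q → State (suc n) (suc p) q t
extend {n} {q = zero} st _ = ext st idₚ (λ _ → false) (λ _ ()) (sum-zero {n} _ λ _ → refl)
extend {n} {p} {suc q} {t} st t≤ with lightPermutation q p (λ i j → mv (cell st i j)) (regC st)
    (≤-trans (≤-reflexive (trans (sum-cong-≗ λ i → sum-cong-≗ λ j → cm≡m (cell st i j)) (count st))) t≤)
  where
  cm≡m : ∀ x → cv x * mv x ≡ mv x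
  cm≡m inA = refl
  cm≡m inB = refl
  cm≡m inC = refl
  cm≡m inBC = refl
... | π , light , inQ with subset g (suc q) enough
  where
  g : Fin n → Bool
  g i = isC (cell st i (π ⟨$⟩ʳ i))
  not-isC : ∀ x → 1 ≤ cv x → ⟦ not (isC x) ⟧ ≡ mv x
  not-isC inC _ = refl
  not-isC inBC _ = refl
  -- All n = p + (q + 1) + 1 cells of `π` lie in C and at most p of them are `inBC`, so at least q +
  -- 2 are `inC`.
  enough : suc q ≤ sum (⟦_⟧ ∘ g)
  enough = +-cancelʳ-≤ p _ _ (≤-trans (n≤1+n _) (≤-trans (≤-reflexive (trans (cong suc (+-comm (suc q) p)) (trans (sym (size st)) (sym (sum-not g)))))
    (+-monoʳ-≤ (sum (⟦_⟧ ∘ g)) (≤-trans (≤-reflexive (sum-cong-≗ λ i → not-isC (cell st i (π ⟨$⟩ʳ i)) (inQ i))) light))))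
... | s , total , s⊆g = ext st π s (λ i si → isC⇒c _ (s⊆g i si)) total
  where
  isC⇒c : ∀ x → isC x ≡ true → x ≡ inC
  isC⇒c inC _ = refl

-- Up to p * q the induction hypothesis is extended with t unchanged. Above it, t = p * q + e with e
-- at most q, and the chain that starts from `max p q` is stopped after e switches.
exists : ∀ p q t → t ≤ p * q → State (suc (p + q)) p q t
exists zero    q zero _ = state (max-base q)
exists (suc p) q t t≤ with t ≤? p * q
... | yes small = extend (exists p q t small) small
... | no large with m≤n⇒∃[o]m+o≡n (≰⇒≥ large)
...   | e , refl = subst (State _ _ _) (+-comm e (p * q)) (state (chain (max p q) e (+-cancelʳ-≤ (p * q) e q (subst (_≤ q + p * q) (+-comm (p * q) e) t≤))))

-- Translation into integer lines and matrices.

val : Sgn → ℤ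
val pos = 1ℤ
val zer = 0ℤ
val neg = -1ℤ

private
  nz : List ℤ → List ℤ
  nz = filter (λ x → ¬? (x ≟ℤ 0ℤ))

  altFromPlus : ∀ {n} {v : Fin n → Sgn} → Alt false v → AltFromPlus (nz (tabulate (val ∘ v)))
  -- After a +1 the list may stop, but `AltFromMinus` has no empty case; hence the alternative.
  altFromMinus : ∀ {n} {v : Fin n → Sgn} → Alt true v → nz (tabulate (val ∘ v)) ≡ [] ⊎ AltFromMinus (nz (tabulate (val ∘ v)))
  altFromPlus (skip e A) rewrite e = altFromPlus A
  altFromPlus (plus e A) rewrite e with altFromMinus A
  ... | inj₁ empty rewrite empty = last
  ... | inj₂ alt = step alt
  altFromMinus end = inj₁ refl
  altFromMinus (skip e A) rewrite e = altFromMinus A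
  altFromMinus (minus e A) rewrite e = inj₂ (step (altFromPlus A))

  isSign : ∀ x → IsSign (val x)
  isSign zer = inj₁ refl
  isSign pos = inj₂ (inj₁ refl)
  isSign neg = inj₂ (inj₂ refl)

Alt⇒IsAltLine : ∀ {n} {v : Fin n → Sgn} → Alt false v → IsAltLine (val ∘ v)
Alt⇒IsAltLine {n} {v} A = (λ i → isSign (v i)) , subst (AltFromPlus ∘ nz) (sym (map-tabulate id (val ∘ v))) (altFromPlus A)

isNeg : ℤ → Bool
isNeg x = does (x ≟ℤ -1ℤ)

private
  negs : List ℤ → ℕ
  negs xs = length (filter (λ x → x ≟ℤ -1ℤ) xs)

  negs-tabulate : ∀ {n} (f : Fin n → ℤ) → negs (tabulate f) ≡ sum (λ i → ⟦ isNeg (f i) ⟧)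
  negs-tabulate {zero}  f = refl
  negs-tabulate {suc n} f with does (f zero ≟ℤ -1ℤ)
  ... | true  = cong suc (negs-tabulate (f ∘ suc))
  ... | false = negs-tabulate (f ∘ suc)

  -- The row index runs through an arbitrary `g` because the tail of `allFin` is a reindexed
  -- tabulation.
  negs-concatMap : ∀ {l n} (M : Fin l → Fin n → ℤ) {k} (g : Fin k → Fin l) →
    negs (concatMap (λ i → map (M i) (allFin n)) (tabulate g)) ≡ sum (λ i → sum (λ j → ⟦ isNeg (M (g i) j) ⟧))
  negs-concatMap M {zero} g = refl
  negs-concatMap {n = n} M {suc k} g = begin
    negs (row ++ rest)                          ≡⟨ cong length (filter-++ (λ x → x ≟ℤ -1ℤ) row rest) ⟩
    length (filter (λ x → x ≟ℤ -1ℤ) row ++ filter (λ x → x ≟ℤ -1ℤ) rest) ≡⟨ length-++ (filter (λ x → x ≟ℤ -1ℤ) row) ⟩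
    negs row + negs rest                        ≡⟨ cong₂ _+_ (trans (cong negs (map-tabulate id (M (g zero)))) (negs-tabulate (M (g zero)))) (negs-concatMap M (g ∘ suc)) ⟩
    sum (λ i → sum (λ j → ⟦ isNeg (M (g i) j) ⟧)) ∎
    where
    open ≡-Reasoning
    row = map (M (g zero)) (allFin n)
    rest = concatMap (λ i → map (M i) (allFin n)) (tabulate (g ∘ suc))

σ-≡∑∑ : ∀ {n} (M : Matrix n) → σ- M ≡ sum (λ i → sum (λ j → ⟦ isNeg (M i j) ⟧))
σ-≡∑∑ M = negs-concatMap M id

-- Assembling the hypermatrix

permutations : ∀ {n r} {M : Fin n → Fin n → ℕ} → PermSum r M → ∃ λ (πs : Fin r → Permutation′ n) → ∀ i j → sum (λ s → mat (πs s) i j) ≡ M i j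
permutations ([] z) = (λ ()) , λ i j → sym (z i j)
permutations (cons π R e) with permutations R
... | πs , eq = (λ { zero → π ; (suc s) → πs s }) , λ i j → trans (cong (mat π i j +_) (eq i j)) (sym (e i j))

entry : Bool → Sgn
entry x = if x then pos else zer

-- On a vertical line the first p entries come from the summands of B, and the number of 1s among
-- them is the entry of B. Without a 1 they leave the state alone; a single 1 turns `false` into
-- `true`.
Alt-prefix₀ : ∀ {p k b} {v : Fin (p + k) → Sgn} (f : Fin p → Bool) → (∀ x → v (x ↑ˡ k) ≡ entry (f x)) → sum (⟦_⟧ ∘ f) ≡ 0 →
  Alt b (v ∘ (p ↑ʳ_)) → Alt b v
Alt-prefix₀ {zero}  f e z A = A
Alt-prefix₀ {suc p} f e z A with f zero | e zero
... | false | e₀ = skip e₀ (Alt-prefix₀ (f ∘ suc) (e ∘ suc) z A)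

Alt-prefix₁ : ∀ {p k} {v : Fin (p + k) → Sgn} (f : Fin p → Bool) → (∀ x → v (x ↑ˡ k) ≡ entry (f x)) → sum (⟦_⟧ ∘ f) ≡ 1 →
  Alt true (v ∘ (p ↑ʳ_)) → Alt false v
Alt-prefix₁ {suc p} f e o A with f zero | e zero
... | false | e₀ = skip e₀ (Alt-prefix₁ (f ∘ suc) (e ∘ suc) o A)
... | true  | e₀ = plus e₀ (Alt-prefix₀ (f ∘ suc) (e ∘ suc) (cong pred o) A)

Alt-suffix₀ : ∀ {q} (f : Fin q → Bool) → sum (⟦_⟧ ∘ f) ≡ 0 → Alt true (entry ∘ f)
Alt-suffix₀ {zero}  f z = end
Alt-suffix₀ {suc q} f z with f zero in eq
... | false = skip (cong entry eq) (Alt-suffix₀ (f ∘ suc) z)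

Alt-suffix₁ : ∀ {q} (f : Fin q → Bool) → sum (⟦_⟧ ∘ f) ≡ 1 → Alt false (entry ∘ f)
Alt-suffix₁ {suc q} f o with f zero in eq
... | false = skip (cong entry eq) (Alt-suffix₁ (f ∘ suc) o)
... | true  = plus (cong entry eq) (Alt-suffix₀ (f ∘ suc) (cong pred o))

permSgn : ∀ {n} → Permutation′ n → Fin n → Fin n → Sgn
permSgn π i j = entry (does (π ⟨$⟩ʳ i ≟ j))

permSgn-row : ∀ {n} (π : Permutation′ n) i → Alt false (permSgn π i)
permSgn-row π i = Alt-single (π ⟨$⟩ʳ i) (cong entry (dec-true (π ⟨$⟩ʳ i ≟ π ⟨$⟩ʳ i) refl)) (λ j j≢ → cong entry (dec-false (π ⟨$⟩ʳ i ≟ j) (j≢ ∘ sym)))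

permSgn-col : ∀ {n} (π : Permutation′ n) j → Alt false (λ i → permSgn π i j)
permSgn-col π j = Alt-single (π ⟨$⟩ˡ j) (cong entry (dec-true (π ⟨$⟩ʳ (π ⟨$⟩ˡ j) ≟ j) (inverseʳ π)))
  (λ i i≢ → cong entry (dec-false (π ⟨$⟩ʳ i ≟ j) (λ eq → i≢ (trans (sym (inverseˡ π)) (cong (π ⟨$⟩ˡ_) eq)))))

module Assemble {n p q t} (st : State n p q t) where

  Bs = permutations (regB st)
  Cs = permutations (regC st)

  layer′ : Fin p ⊎ Fin (suc q) → Fin n → Fin n → Sgn
  layer′ (inj₁ s)       = permSgn (proj₁ Bs s)
  layer′ (inj₂ zero)    = λ i j → sgn (cell st i j)
  layer′ (inj₂ (suc s)) = permSgn (proj₁ Cs s)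

  layer : Fin (p + suc q) → Fin n → Fin n → Sgn
  layer s = layer′ (splitAt p s)

  layer-row : ∀ s i → Alt false (layer s i)
  layer-row s i with splitAt p s
  ... | inj₁ s′       = permSgn-row (proj₁ Bs s′) i
  ... | inj₂ zero     = rows st i
  ... | inj₂ (suc s′) = permSgn-row (proj₁ Cs s′) i

  layer-col : ∀ s j → Alt false (λ i → layer s i j)
  layer-col s j with splitAt p s
  ... | inj₁ s′       = permSgn-col (proj₁ Bs s′) j
  ... | inj₂ zero     = cols st j
  ... | inj₂ (suc s′) = permSgn-col (proj₁ Cs s′) j

  -- The nonzeros on the line are a single +1 for `inA`, `inB` and `inC`, placed in, before and
  -- after the middle plane, and +1, -1, +1 for `inBC`.
  layer-vertical : ∀ i j → Alt false (λ s → layer s i j)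
  layer-vertical i j = go (cell st i j) refl
    where
    atB : Fin p → Bool
    atB s = does (proj₁ Bs s ⟨$⟩ʳ i ≟ j)
    atC : Fin q → Bool
    atC s = does (proj₁ Cs s ⟨$⟩ʳ i ≟ j)
    prefix : ∀ x → layer (x ↑ˡ suc q) i j ≡ entry (atB x)
    prefix x = cong (λ s → layer′ s i j) (splitAt-↑ˡ p x (suc q))
    middle : ∀ {x} → cell st i j ≡ x → layer (p ↑ʳ zero) i j ≡ sgn x
    middle eq = trans (cong (λ s → layer′ s i j) (splitAt-↑ʳ p (suc q) zero)) (cong sgn eq)
    suffix : ∀ x → layer (p ↑ʳ suc x) i j ≡ entry (atC x)
    suffix x = cong (λ s → layer′ s i j) (splitAt-↑ʳ p (suc q) (suc x))
    sumB : ∀ {x} → cell st i j ≡ x → sum (⟦_⟧ ∘ atB) ≡ bv x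
    sumB eq = trans (proj₂ Bs i j) (cong bv eq)
    sumC : ∀ {x} → cell st i j ≡ x → sum (⟦_⟧ ∘ atC) ≡ cv x
    sumC eq = trans (proj₂ Cs i j) (cong cv eq)
    go : ∀ x → cell st i j ≡ x → Alt false (λ s → layer s i j)
    go inA eq = Alt-prefix₀ atB prefix (sumB eq) (plus  (middle eq) (Alt-cong suffix (Alt-suffix₀ atC (sumC eq))))
    go inB eq = Alt-prefix₁ atB prefix (sumB eq) (skip  (middle eq) (Alt-cong suffix (Alt-suffix₀ atC (sumC eq))))
    go inC eq = Alt-prefix₀ atB prefix (sumB eq) (skip  (middle eq) (Alt-cong suffix (Alt-suffix₁ atC (sumC eq))))
    go inBC eq = Alt-prefix₁ atB prefix (sumB eq) (minus (middle eq) (Alt-cong suffix (Alt-suffix₁ atC (sumC eq))))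

  val-permSgn : ∀ (π : Permutation′ n) i j → val (permSgn π i j) ≡ (if does (π ⟨$⟩ʳ i ≟ j) then 1ℤ else 0ℤ)
  val-permSgn π i j with does (π ⟨$⟩ʳ i ≟ j)
  ... | true  = refl
  ... | false = refl

  layer-permutation : ∀ s → ¬ (s ≡ p ↑ʳ zero) → IsPermutationMatrix (λ i j → val (layer s i j))
  layer-permutation s s≢ with splitAt p s in eq
  ... | inj₁ s′       = proj₁ Bs s′ , val-permSgn (proj₁ Bs s′)
  ... | inj₂ zero     = contradiction (sym (splitAt⁻¹-↑ʳ eq)) s≢
  ... | inj₂ (suc s′) = proj₁ Cs s′ , val-permSgn (proj₁ Cs s′)

  σ-layer : σ- (λ i j → val (layer (p ↑ʳ zero) i j)) ≡ t
  σ-layer = trans (σ-≡∑∑ (λ i j → val (layer (p ↑ʳ zero) i j))) (trans (sum-cong-≗ λ i → sum-cong-≗ λ j →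
      trans (cong (λ s → ⟦ isNeg (val (layer′ s i j)) ⟧) (splitAt-↑ʳ p (suc q) zero)) (neg≡mv (cell st i j))) (count st))
    where
    neg≡mv : ∀ x → ⟦ isNeg (val (sgn x)) ⟧ ≡ mv x
    neg≡mv inA = refl
    neg≡mv inB = refl
    neg≡mv inC = refl
    neg≡mv inBC = refl

-- The number of entries -1 of F

negOnePow≡-1⇒odd : ∀ w → negOnePow w ≡ -1ℤ → ∃ λ β → w ≡ suc (β + β)
negOnePow≡-1⇒odd (suc zero)    _  = 0 , refl
negOnePow≡-1⇒odd (suc (suc w)) eq with negOnePow≡-1⇒odd w (trans (sym (neg-involutive (negOnePow w))) eq)
... | β , refl = suc β , cong (λ z → suc (suc z)) (sym (+-suc β β))

private
  does⇒ : ∀ {P : Set} (d : Dec P) → does d ≡ true → P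
  does⇒ (yes p) _ = p

  if≡-1 : ∀ x y z {v} → (if x ∧ y ∧ z then v else 0ℤ) ≡ -1ℤ → x ≡ true × y ≡ true × z ≡ true × v ≡ -1ℤ
  if≡-1 true true true eq = refl , refl , refl , eq

  double-< : ∀ {x y} → suc (x + x) ≤ y + y → x < y
  double-< {x} {y} lt = ≰⇒> λ y≤x → <⇒≱ lt (+-mono-≤ y≤x y≤x)

-- `β` comes from x + y = p + 2β + 1 and `α` from x = α + β + 1. The band condition gives β < x, so
-- that `α` exists, and α < p; the upper bound on x + y gives β < q.
minusAt : ∀ {p q} x y → p ≤ x + y → x + y ≤ p + (q + q) → ∣ x - y ∣ ≤ p → negOnePow (x + y ∸ p) ≡ -1ℤ →
  ∃₂ λ α β → α < p × β < q × x ≡ suc (α + β) × y ≡ p ∸ α + β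
minusAt {p} {q} x y p≤ ≤p+2q close odd with m≤n⇒∃[o]m+o≡n p≤
... | w , p+w≡x+y with negOnePow≡-1⇒odd w (trans (cong negOnePow (trans (sym (m+n∸m≡n p w)) (cong (_∸ p) p+w≡x+y))) odd)
...   | β , refl with m≤n⇒∃[o]m+o≡n β<x
  where
  y≤x+p : y ≤ x + p
  y≤x+p = ≤-trans (m≤n+∣n-m∣ y x) (+-monoʳ-≤ x close)
  β<x : β < x
  β<x = double-< (+-cancelˡ-≤ p _ _ (≤-trans (≤-reflexive p+w≡x+y) (≤-trans (+-monoʳ-≤ x y≤x+p) (≤-reflexive (rearr x p)))))
    where
    rearr : ∀ x p → x + (x + p) ≡ p + (x + x)
    rearr = solve-∀
...     | α , refl = α , β , α<p , β<q , cong suc (+-comm β α) , y≡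
  where
  α+y≡p+β : α + y ≡ p + β
  α+y≡p+β = +-cancelˡ-≡ (suc β) _ _ (trans (sym (+-assoc (suc β) α y)) (trans (sym p+w≡x+y) (rearr p β)))
    where
    rearr : ∀ p β → p + suc (β + β) ≡ suc β + (p + β)
    rearr = solve-∀
  x≤y+p : suc β + α ≤ y + p
  x≤y+p = ≤-trans (m≤n+∣m-n∣ (suc β + α) y) (+-monoʳ-≤ y close)
  α<p : α < p
  α<p = ≰⇒> λ p≤α → <⇒≱ x≤y+p (begin
    y + p   ≤⟨ +-monoʳ-≤ y p≤α ⟩
    y + α   ≡⟨ +-comm y α ⟩
    α + y   ≡⟨ α+y≡p+β ⟩
    p + β   ≤⟨ +-monoˡ-≤ β p≤α ⟩
    α + β   ≡⟨ +-comm α β ⟩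
    β + α   ∎)
    where open ≤-Reasoning
  β<q : β < q
  β<q = double-< (+-cancelˡ-≤ p _ _ (≤-trans (≤-reflexive p+w≡x+y) ≤p+2q))
  y≡ : y ≡ p ∸ α + β
  y≡ = trans (sym (m+n∸m≡n α y)) (trans (cong (_∸ α) α+y≡p+β) (+-∸-comm β (<⇒≤ α<p)))

-- With a = x + 1, b = y + 1, k = p + 1 and n = p + q + 1, the bounds on a + b in `F` become p ≤ x +
-- y ≤ p + 2q, and the exponent becomes x + y - p.
F≡-1⇒minusAt : ∀ p q (i j : Fin (p + suc q)) → F (p + suc q) (suc p) i j ≡ -1ℤ →
  ∃₂ λ α β → α < p × β < q × toℕ i ≡ suc (α + β) × toℕ j ≡ p ∸ α + β
F≡-1⇒minusAt p q i j eq with if≡-1 (does (suc (suc p) ≤? suc x + suc y)) (does (suc x + suc y ≤? 2 * (p + suc q) ∸ suc p + 1)) (does (∣ suc x - suc y ∣ ≤? p)) eq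
  where
  x = toℕ i
  y = toℕ j
... | d₁ , d₂ , d₃ , odd = minusAt {p} {q} x y p≤ ≤p+2q (does⇒ (∣ suc x - suc y ∣ ≤? p) d₃)
        (trans (cong negOnePow (sym (trans (cong (λ z → z ∸ p ∸ 1) (+-suc x y)) (cong (_∸ 1) (+-∸-assoc 1 p≤))))) odd)
  where
  x = toℕ i
  y = toℕ j
  p≤ : p ≤ x + y
  p≤ = s≤s⁻¹ (subst (suc p ≤_) (+-suc x y) (s≤s⁻¹ (does⇒ (suc (suc p) ≤? suc x + suc y) d₁)))
  bound : 2 * (p + suc q) ∸ suc p + 1 ≡ suc (suc (p + (q + q)))
  bound = trans (cong (λ z → z ∸ suc p + 1) (rearr p q)) (trans (cong (_+ 1) (m+n∸m≡n (suc p) (suc (p + (q + q))))) (+-comm _ 1))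
    where
    rearr : ∀ p q → 2 * (p + suc q) ≡ suc p + suc (p + (q + q))
    rearr = solve-∀
  ≤p+2q : x + y ≤ p + (q + q)
  ≤p+2q = s≤s⁻¹ (s≤s⁻¹ (subst₂ _≤_ (cong suc (+-suc x y)) bound (does⇒ (suc x + suc y ≤? 2 * (p + suc q) ∸ suc p + 1) d₂)))

sum-mono-≤ : ∀ {n} {f g : Fin n → ℕ} → (∀ i → f i ≤ g i) → sum f ≤ sum g
sum-mono-≤ {zero}  le = z≤n
sum-mono-≤ {suc n} le = +-mono-≤ (le zero) (sum-mono-≤ (le ∘ suc))

term≤sum : ∀ {n} (f : Fin n → ℕ) i → f i ≤ sum f
term≤sum f zero    = m≤m+n _ _
term≤sum f (suc i) = ≤-trans (term≤sum (f ∘ suc) i) (m≤n+m _ (f zero))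

at : ∀ {n} → ℕ → Fin n → ℕ
at u x = ⟦ does (toℕ x ≟ℕ u) ⟧

at-≡ : ∀ {n u} (x : Fin n) → toℕ x ≡ u → at u x ≡ 1
at-≡ {u = u} x eq = cong ⟦_⟧ (dec-true (toℕ x ≟ℕ u) eq)

sum-at : ∀ {n} u → sum {n} (at u) ≤ 1
sum-at {zero}  u       = z≤n
sum-at {suc n} zero    = ≤-reflexive (cong suc (sum-zero {n} _ λ _ → refl))
sum-at {suc n} (suc u) = sum-at {n} u

∑∑-at : ∀ {n} u v → sum {n} (λ i → sum {n} (λ j → at u i * at v j)) ≤ 1
∑∑-at {n} u v = ≤-trans (sum-mono-≤ {n} (λ i → row (does (toℕ i ≟ℕ u)))) (sum-at {n} u)
  where
  row : ∀ x → sum {n} (λ j → ⟦ x ⟧ * at v j) ≤ ⟦ x ⟧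
  row true  = ≤-trans (≤-reflexive (sum-cong-≗ {n} λ j → *-identityˡ (at v j))) (sum-at {n} v)
  row false = ≤-reflexive (sum-zero {n} _ λ _ → refl)

∑∑∑-comm : ∀ {k l r} (f : Fin k → Fin l → Fin r → ℕ) → sum (λ i → sum (λ j → sum (λ s → f i j s))) ≡ sum (λ s → sum (λ i → sum (λ j → f i j s)))
∑∑∑-comm f = trans (sum-cong-≗ λ i → ∑-comm (f i)) (∑-comm λ i s → sum (λ j → f i j s))

sum-≤-* : ∀ {n} (f : Fin n → ℕ) u → (∀ i → f i ≤ u) → sum f ≤ n * u
sum-≤-* {zero}  f u le = z≤n
sum-≤-* {suc n} f u le = +-mono-≤ (le zero) (sum-≤-* (f ∘ suc) u (le ∘ suc))

-- Each entry -1 is among the cells parametrised by the pq pairs `(α , β)`, and each pair accounts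
-- for at most one cell; the sums are exchanged to count by pairs.
σ-F≤ : ∀ p q → σ- (F (p + suc q) (suc p)) ≤ p * q
σ-F≤ p q = begin
  σ- (F n (suc p))                                                                     ≡⟨ σ-≡∑∑ (F n (suc p)) ⟩
  sum (λ i → sum (λ j → ⟦ isNeg (F n (suc p) i j) ⟧))                                  ≤⟨ sum-mono-≤ (λ i → sum-mono-≤ (λ j → cover i j)) ⟩
  sum (λ i → sum (λ j → sum (λ α → sum (λ β → G α β i j))))                            ≡⟨ ∑∑∑-comm (λ i j α → sum (λ β → G α β i j)) ⟩
  sum (λ α → sum (λ i → sum (λ j → sum (λ β → G α β i j))))                            ≡⟨ sum-cong-≗ (λ α → ∑∑∑-comm (λ i j β → G α β i j)) ⟩
  sum (λ α → sum (λ β → sum (λ i → sum (λ j → G α β i j))))                            ≤⟨ sum-≤-* {p} _ (q * 1) (λ α → sum-≤-* {q} _ 1 (λ β → ∑∑-at {n} (suc (toℕ α + toℕ β)) (p ∸ toℕ α + toℕ β))) ⟩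
  p * (q * 1)                                                                          ≡⟨ cong (p *_) (*-identityʳ q) ⟩
  p * q                                                                                ∎
  where
  open ≤-Reasoning
  n = p + suc q
  G : Fin p → Fin q → Fin n → Fin n → ℕ
  G α β i j = at (suc (toℕ α + toℕ β)) i * at (p ∸ toℕ α + toℕ β) j
  cover : ∀ i j → ⟦ isNeg (F n (suc p) i j) ⟧ ≤ sum (λ α → sum (λ β → G α β i j))
  cover i j with F n (suc p) i j ≟ℤ -1ℤ
  ... | no _ = z≤n
  ... | yes eq with F≡-1⇒minusAt p q i j eq
  ...   | α , β , α<p , β<q , i≡ , j≡ = ≤-trans (≤-reflexive (sym G≡1)) (≤-trans (term≤sum (λ β → G α′ β i j) β′) (term≤sum (λ α → sum (λ β → G α β i j)) α′))
    where
    α′ = fromℕ< α<p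
    β′ = fromℕ< β<q
    G≡1 : G α′ β′ i j ≡ 1
    G≡1 = cong₂ _*_ (at-≡ i (trans i≡ (sym (cong₂ (λ u v → suc (u + v)) (toℕ-fromℕ< α<p) (toℕ-fromℕ< β<q)))))
                    (at-≡ j (trans j≡ (sym (cong₂ (λ u v → p ∸ u + v) (toℕ-fromℕ< α<p) (toℕ-fromℕ< β<q)))))

-- Matching on a position turns n into p + (q + 1) and k into the plane right after the first p, the
-- form in which `Assemble` stacks its planes.
data Position : (n : ℕ) → Fin n → Set where
  position : ∀ p q → Position (p + suc q) (p ↑ʳ zero)

locate : ∀ {n} (k : Fin n) → Position n k
locate {suc n} zero = position 0 n
locate (suc k) with locate k
... | position p q = position (suc p) q

theorem4p6 : (n : ℕ) (k : Fin n) (t : ℕ) → t ≤ σ- (F n (suc (toℕ k))) →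
    ∃ λ (H : Hypermatrix n) →
    IsASHM H
    × IsASM (plane H k)
    × σ- (plane H k) ≡ t
    × (∀ (s : Fin n) → ¬ (s ≡ k) → IsPermutationMatrix (plane H s))
theorem4p6 n k t t≤ with locate k
... | position p q = (λ i j s → val (layer s i j))
    , ((λ j s → Alt⇒IsAltLine (layer-col s j)) , (λ i s → Alt⇒IsAltLine (layer-row s i)) , (λ i j → Alt⇒IsAltLine (layer-vertical i j)))
    , ((λ i → Alt⇒IsAltLine (layer-row (p ↑ʳ zero) i)) , (λ j → Alt⇒IsAltLine (layer-col (p ↑ʳ zero) j)))
    , σ-layer , layer-permutation
  where
  -- The order suc (p + q) of the constructed state is transported to p + suc q, and the bound on t
  -- passes through `σ-F≤` after `toℕ` of the position has been evaluated to p.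
  open Assemble (subst (λ n → State n p q t) (sym (+-suc p q)) (exists p q t (≤-trans t≤
    (subst (λ k → σ- (F (p + suc q) (suc k)) ≤ p * q) (sym (trans (toℕ-↑ʳ p zero) (+-identityʳ p))) (σ-F≤ p q)))))
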